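{- Let $\mathcal R$ be a set of one-step sound one-step rules (in sequent format, for a given $\Lambda$-structure) that absorbs multicut. Then the rule $\mathsf{Mcut}$ is admissible in the sequent system $\mathcal{SR}$: every sequent derivable in $\mathcal{SR}$ extended with $\mathsf{Mcut}$ is derivable in $\mathcal{SR}$. Therefore, the rule $\mathsf{Cut}$ is also admissible in $\mathcal{SR}$.
   Context: **Syntax.** $\Lambda$ is a set of modal operators and $\Sigma$ a set of predicate symbols, each with a finite arity; there is a fixed supply of individual variables. Formulas of $\mathrm{CPL}(\Lambda,\Sigma)$: $\phi::= y_1=y_2\mid P(\vec x)\mid\bot\mid\phi\to\psi\mid\forall x.\phi\mid x\heartsuit\lceil y_1:\phi_1\rceil\dots\lceil y_n:\phi_n\rceil$ ($\heartsuit$ $n$-ary; $x$ free, $y_i$ bound in $\phi_i$). $\phi[t/x]$ is substitution of the variable $t$ for the free occurrences of $x$, written only if $t$ is substitutable for $x$ in $\phi$, i.e. no capture occurs (otherwise, bound variables of $\phi$ are suitably renamed first). A sequent $\Gamma\Rightarrow\Delta$ is a pair of finite multisets of formulas. **One-step rules in sequent format.** Over a fixed collection of schematic variables, a one-step rule $R$ has premises $\Gamma_1\Rightarrow\Delta_1,\dots,\Gamma_k\Rightarrow\Delta_k$, where $\Gamma_i,\Delta_i$ are finite multisets of schematic variables, and a conclusion $\Gamma_R\Rightarrow\Delta_R$ of the form $\heartsuit_1\vec p_1,\dots,\heartsuit_n\vec p_n\Rightarrow\heartsuit_{n+1}\vec p_{n+1},\dots,\heartsuit_{n+m}\vec p_{n+m}$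 (with $\vec p_i$ a tuple of schematic variables of length the arity of $\heartsuit_i$); every schematic variable occurs at most once in the conclusion and every variable of the premises occurs in the conclusion. A $\Lambda$-structure is a functor $T:\mathsf{Set}\to\mathsf{Set}$ with, for each $n$-ary $\heartsuit\in\Lambda$, maps $\llbracket\heartsuit\rrbracket_C:\mathcal P(C)^n\to\mathcal P(TC)$ for all sets $C$, natural: $(Tf)^{ -1}[\llbracket\heartsuit\rrbracket_D(B_1,\dots,B_n)]=\llbracket\heartsuit\rrbracket_C(f^{ -1}[B_1],\dots,f^{ -1}[B_n])$ for $f:C\to D$. The rule $R$ is one-step sound if for every set $C$ and every assignment $\tau$ of subsets of $C$ to schematic variables: if $\bigcap_{p\in\Gamma_i}\tau(p)\subseteq\bigcup_{p\in\Delta_i}\tau(p)$ for all $i\le k$ (empty intersection being $C$), then $\bigcap_{j\le n}\llbracket\heartsuit_j\rrbracket_C(\tau(\vec p_j))\subseteq\bigcup_{j>n}\llbracket\heartsuit_j\rrbracket_C(\tau(\vec p_j))$ (empty intersection being $TC$). **System $\mathcal{SR}$.** Axioms: $\phi\Rightarrow\phi$; $\bot\Rightarrow$; $\Rightarrow x=x$. Rules (premises / conclusion; $\dagger$: $y$ fresh, i.e. not free, in the conclusion): - $\phi,\Gamma\Rightarrow\Delta,\psi\ /\ \Gamma\Rightarrow\Delta,\phi\to\psi$; and $\Gamma\Rightarrow\Delta,\phi$ and $\psi,\Gamma\Rightarrow\Delta\ /\ \phi\to\psi,\Gamma\Rightarrow\Delta$; - $\Gamma\Rightarrow\Delta,\phi[y/x]\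 /\ \Gamma\Rightarrow\Delta,\forall x.\phi$ ($\dagger$); $\phi[z/x],\Gamma\Rightarrow\Delta\ /\ \forall x.\phi,\Gamma\Rightarrow\Delta$; - $x=y,\Gamma[x/z]\Rightarrow\Delta[x/z]\ /\ x=y,\Gamma[y/z]\Rightarrow\Delta[y/z]$, and the same rule with premise and conclusion exchanged; - left and right weakening and contraction; - for each $R\in\mathcal R$, $\mathcal S(R)$ ($\dagger$): from $\Sigma',\Gamma_i\sigma\Rightarrow\Delta_i\sigma,\Theta$ ($1\le i\le k$) infer $\Sigma',z\heartsuit_1\lceil\boldsymbol{x_1:\phi_1}\rceil,\dots,z\heartsuit_n\lceil\boldsymbol{x_n:\phi_n}\rceil\Rightarrow z\heartsuit_{n+1}\lceil\boldsymbol{x_{n+1}:\phi_{n+1}}\rceil,\dots,z\heartsuit_{n+m}\lceil\boldsymbol{x_{n+m}:\phi_{n+m}}\rceil,\Theta$, where $\lceil\boldsymbol{x_i:\phi_i}\rceil$ abbreviates $\lceil x_i^1:\phi_i^1\rceil\dots\lceil x_i^{a}:\phi_i^{a}\rceil$ ($a$ the arity of $\heartsuit_i$) and $\sigma$ sends $p_i^j$ to $\phi_i^j[y/x_i^j]$. **Cut rules.** $\mathsf{Cut}$: from $\Gamma\Rightarrow\Delta,\phi$ and $\phi,\Sigma'\Rightarrow\Theta$ infer $\Gamma,\Sigma'\Rightarrow\Delta,\Theta$. $\mathsf{Mcut}$: from $\Gamma\Rightarrow\Delta,\phi^m$ and $\phi^n,\Sigma'\Rightarrow\Theta$ infer $\Gamma,\Sigma'\Rightarrow\Delta,\Theta$,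 where $m,n\ge1$ and $\phi^k$ denotes $k$ copies of $\phi$. **Absorption of multicut.** For finite sets $\mathbb S,\mathbb S'$ of sequents, $\mathbb S\rhd\mathbb S'$ ($\mathbb S$ covers $\mathbb S'$) if each $\Gamma\Rightarrow\Delta$ in $\mathbb S'$ contains some $\Pi\Rightarrow\Sigma'$ in $\mathbb S$, i.e. $\Pi\subseteq\Gamma$ and $\Sigma'\subseteq\Delta$; single sequents are identified with singletons. $\mathsf{MCut}(\mathbb S)$ is the set of sequents derivable from premises in $\mathbb S$ using only one application of $\mathsf{Mcut}$. $\mathcal R$ absorbs multicut if for all pairs $(R_1,R_2)$ of rules in $\mathcal R$ of the form $R_1$: $\Gamma_{11}\Rightarrow\Delta_{11},\dots,\Gamma_{1r_1}\Rightarrow\Delta_{1r_1}\ /\ \Gamma_{R_1}\Rightarrow\Delta_{R_1},(\heartsuit\vec p)^m$ and $R_2$: $\Gamma_{21}\Rightarrow\Delta_{21},\dots,\Gamma_{2r_2}\Rightarrow\Delta_{2r_2}\ /\ (\heartsuit\vec p)^n,\Gamma_{R_2}\Rightarrow\Delta_{R_2}$ there is a rule $R=\Gamma_1\Rightarrow\Delta_1,\dots,\Gamma_k\Rightarrow\Delta_k/\Gamma_R\Rightarrow\Delta_R$ in $\mathcal R$ such that $\mathsf{MCut}(\{\Gamma_{11}\Rightarrow\Delta_{11},\dots,\Gamma_{1r_1}\Rightarrow\Delta_{1r_1},\Gamma_{21}\Rightarrow\Delta_{21},\dots,\Gamma_{2r_2}\Rightarrow\Delta_{2r_2}\})\rhd\{\Gamma_1\Rightarrow\Delta_1,\dots,\Gamma_k\Rightarrow\Delta_k\}$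 and $\Gamma_R\Rightarrow\Delta_R\rhd\Gamma_{R_1},\Gamma_{R_2}\Rightarrow\Delta_{R_1},\Delta_{R_2}$.
   Formalization: In "absorbs multicut", the rules R₁, R₂ and R range over instances of members of 𝓡 under renaming, possibly identifying, schematic variables; read literally for the rules as written, the claim fails, e.g. for the single rule p,q⇒r / ♥p,♥q⇒♥r. -}

module Defs where

open import Level using (Level; 0ℓ)
open import Data.Fin using (Fin; zero; suc)
open import Data.List using (List; []; _∷_; _++_; map; concatMap; replicate)
open import Data.List.Membership.Propositional using (_∈_; _∉_)
open import Data.List.Relation.Binary.Permutation.Propositional using (_↭_)
open import Data.List.Relation.Unary.All using (All)
open import Data.List.Relation.Unary.Any using (Any)
open import Data.List.Relation.Unary.Unique.Propositional using (Unique)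
open import Data.Nat using (ℕ; suc; _≤_; _≟_)
open import Data.Product using (∃-syntax; _×_)
open import Data.Vec using (Vec; []; _∷_)
import Data.Vec as Vec
open import Data.Vec.Relation.Binary.Pointwise.Inductive using (Pointwise)
open import Function using (_∘_; id)
open import Relation.Binary.PropositionalEquality using (_≗_)
open import Relation.Nullary using (yes; no)
open import Relation.Unary using (Pred; ｛_｝; _≐_) renaming (_∈_ to _∈ₚ_; _⊢_ to _⁻¹[_])

------------------------------------------------------------------------
-- Multisets and sequents

-- A finite multiset is a list considered up to permutation; accordingly two
-- sequents are the same when they are related by _≋_.

infix 4 _⇒_ _≋_ _⊆ₘ_ _⊑_ _▷_

record Sequent (A : Set) : Set where
  constructor _⇒_
  field
    ante : List A
    succ : List A

open Sequent public

mapSequent : {A B : Set} → (A → B) → Sequent A → Sequent B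
mapSequent f (Γ ⇒ Δ) = map f Γ ⇒ map f Δ

_≋_ : {A : Set} → Sequent A → Sequent A → Set
(Γ ⇒ Δ) ≋ (Γ′ ⇒ Δ′) = Γ ↭ Γ′ × Δ ↭ Δ′

_⊆ₘ_ : {A : Set} → List A → List A → Set
xs ⊆ₘ ys = ∃[ zs ] xs ++ zs ↭ ys

_⊑_ : {A : Set} → Sequent A → Sequent A → Set
(Π ⇒ Σ′) ⊑ (Γ ⇒ Δ) = Π ⊆ₘ Γ × Σ′ ⊆ₘ Δ

_▷_ : {A : Set} → Pred (Sequent A) 0ℓ → Pred (Sequent A) 0ℓ → Set
𝕊 ▷ 𝕊′ = ∀ {S′} → S′ ∈ₚ 𝕊′ → ∃[ S ] S ∈ₚ 𝕊 × S ⊑ S′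

-- Two-premise rules, as relations between the two premises and the conclusion.

Rule₂ : Set → Set₁
Rule₂ A = Sequent A → Sequent A → Sequent A → Set

data NoRule {A : Set} : Rule₂ A where

data Cut {A : Set} : Rule₂ A where
  cut : ∀ Γ Δ Σ′ Θ φ →
        Cut (Γ ⇒ φ ∷ Δ) (φ ∷ Σ′ ⇒ Θ) (Γ ++ Σ′ ⇒ Δ ++ Θ)

data Mcut {A : Set} : Rule₂ A where
  mcut : ∀ Γ Δ Σ′ Θ φ {m n} → 1 ≤ m → 1 ≤ n →
         Mcut (Γ ⇒ Δ ++ replicate m φ) (replicate n φ ++ Σ′ ⇒ Θ)
              (Γ ++ Σ′ ⇒ Δ ++ Θ)

-- Sequents derivable from 𝕊 by at most one application of Mcut, so that
-- 𝕊 itself is included.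

data MCut {A : Set} (𝕊 : Pred (Sequent A) 0ℓ) : Pred (Sequent A) 0ℓ where
  none : ∀ {S} → S ∈ₚ 𝕊 → S ∈ₚ MCut 𝕊
  one  : ∀ {S₁ S₂ P₁ P₂ S} → S₁ ∈ₚ 𝕊 → S₂ ∈ₚ 𝕊 →
         S₁ ≋ P₁ → S₂ ≋ P₂ → Mcut P₁ P₂ S → S ∈ₚ MCut 𝕊

------------------------------------------------------------------------

record Signature : Set₁ where
  field
    Λ   : Set
    ar  : Λ → ℕ
    Sym : Set
    arₛ : Sym → ℕ

-- Individual variables and schematic variables are both drawn from ℕ.

Name SVar : Set
Name = ℕ
SVar = ℕ

module CPL (𝒮 : Signature) where

  open Signature 𝒮

  ----------------------------------------------------------------------
  -- Formulas

  -- Formulas up to renaming of bound variables, in locally nameless form: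
  -- bound variables are de Bruijn indices, while free variables keep their
  -- names.  The formulas of the logic are the elements of Formula 0; a body
  -- φ of ∀x.φ or of ⌈x : φ⌉ is an element of Formula 1, in which the index
  -- zero stands for x.

  data Var (k : ℕ) : Set where
    free  : Name → Var k
    bound : Fin k → Var k

  infix  8 _≈_
  infixr 6 _⊃_

  data Formula (k : ℕ) : Set where
    _≈_   : Var k → Var k → Formula k
    pred  : (P : Sym) → Vec (Var k) (arₛ P) → Formula k
    ⊥ᶠ    : Formula k
    _⊃_   : Formula k → Formula k → Formula k
    ∀ᶠ    : Formula (suc k) → Formula k
    modal : Var k → (♥ : Λ) → Vec (Formula (suc k)) (ar ♥) → Formula k

  lift : ∀ {k l} → (Var k → Var l) → Var (suc k) → Var (suc l)
  lift {k} {l} f v = go v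
    where
    weaken : Var l → Var (suc l)
    weaken (free a)  = free a
    weaken (bound i) = bound (suc i)

    go : Var (suc k) → Var (suc l)
    go (free a)        = weaken (f (free a))
    go (bound zero)    = bound zero
    go (bound (suc i)) = weaken (f (bound i))

  mutual
    rename : ∀ {k l} → (Var k → Var l) → Formula k → Formula l
    rename f (u ≈ v)        = f u ≈ f v
    rename f (pred P us)    = pred P (Vec.map f us)
    rename f ⊥ᶠ             = ⊥ᶠ
    rename f (φ ⊃ ψ)        = rename f φ ⊃ rename f ψ
    rename f (∀ᶠ φ)         = ∀ᶠ (rename (lift f) φ)
    rename f (modal u ♥ φs) = modal (f u) ♥ (renames (lift f) φs)

    renames : ∀ {k l n} → (Var k → Var l) → Vec (Formula k) n → Vec (Formula l) n
    renames f []       = []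
    renames f (φ ∷ φs) = rename f φ ∷ renames f φs

  -- φ [ t / x ] for a free variable x.

  infix 9 _[_/_]

  _[_/_] : ∀ {k} → Formula k → Name → Name → Formula k
  _[_/_] {k} φ t x = rename f φ
    where
    f : Var k → Var k
    f (bound i) = bound i
    f (free a) with a ≟ x
    ... | yes _ = free t
    ... | no  _ = free a

  -- φ [ t / x ] for the variable x that has been bound in the body φ.

  infix 9 _⟨_⟩

  _⟨_⟩ : Formula 1 → Name → Formula 0
  φ ⟨ t ⟩ = rename f φ
    where
    f : Var 1 → Var 0
    f (free a)     = free a
    f (bound zero) = free t

  fvᵛ : ∀ {k} → Var k → List Name
  fvᵛ (free a)  = a ∷ []
  fvᵛ (bound _) = []

  mutual
    fv : ∀ {k} → Formula k → List Name
    fv (u ≈ v)        = fvᵛ u ++ fvᵛ v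
    fv (pred P us)    = concatMap fvᵛ (Vec.toList us)
    fv ⊥ᶠ             = []
    fv (φ ⊃ ψ)        = fv φ ++ fv ψ
    fv (∀ᶠ φ)         = fv φ
    fv (modal u ♥ φs) = fvᵛ u ++ fvs φs

    fvs : ∀ {k n} → Vec (Formula k) n → List Name
    fvs []       = []
    fvs (φ ∷ φs) = fv φ ++ fvs φs

  _FreshFor_ : Name → Sequent (Formula 0) → Set
  y FreshFor (Γ ⇒ Δ) = y ∉ concatMap fv (Γ ++ Δ)

  ----------------------------------------------------------------------
  -- One-step rules

  -- An atom ♥ p₁ … pₙ over schematic variables.

  record Atom : Set where
    constructor _·_
    field
      op   : Λ
      args : Vec SVar (ar op)

  svars : Atom → List SVar
  svars (_ · ps) = Vec.toList ps

  record Schema : Set where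
    constructor _/_
    field
      premises   : List (Sequent SVar)
      conclusion : Sequent Atom

  open Schema public

  conclusionVars : Schema → List SVar
  conclusionVars R = concatMap svars (ante (conclusion R) ++ succ (conclusion R))

  record OneStepRule : Set where
    field
      schema : Schema
      linear : Unique (conclusionVars schema)
      scoped : All (λ P → All (_∈ conclusionVars schema) (ante P ++ succ P))
                   (premises schema)

  open OneStepRule public

  ----------------------------------------------------------------------
  -- Λ-structures and one-step soundness

  -- Sets are modelled by types, subsets of C by predicates on C.  Equality of
  -- functions and of subsets is extensional, so both the action of the functor
  -- and the predicate liftings are required to respect it.

  record Structure : Set₁ where
    field
      T        : Set → Set
      T₁       : ∀ {C D} → (C → D) → T C → T D
      T₁-cong  : ∀ {C D} {f g : C → D} → f ≗ g → T₁ f ≗ T₁ g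
      T₁-id    : ∀ {C} → T₁ (id {A = C}) ≗ id
      T₁-∘     : ∀ {C D E} (g : D → E) (f : C → D) → T₁ (g ∘ f) ≗ T₁ g ∘ T₁ f
      ⟦_⟧      : (♥ : Λ) → ∀ {C} → Vec (Pred C 0ℓ) (ar ♥) → Pred (T C) 0ℓ
      ⟦⟧-cong  : ∀ ♥ {C} {Bs Bs′ : Vec (Pred C 0ℓ) (ar ♥)} →
                 Pointwise _≐_ Bs Bs′ → ⟦ ♥ ⟧ Bs ≐ ⟦ ♥ ⟧ Bs′
      natural  : ∀ ♥ {C D} (f : C → D) (Bs : Vec (Pred D 0ℓ) (ar ♥)) →
                 (T₁ f ⁻¹[ ⟦ ♥ ⟧ Bs ]) ≐ ⟦ ♥ ⟧ (Vec.map (f ⁻¹[_]) Bs)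

  -- The intersection of the antecedent is included in the union of the
  -- succedent, when v interprets the entries as subsets of X.

  _⊨_ : ∀ {A X : Set} → (A → Pred X 0ℓ) → Sequent A → Set
  v ⊨ (Γ ⇒ Δ) = ∀ x → All (λ a → x ∈ₚ v a) Γ → Any (λ a → x ∈ₚ v a) Δ

  OneStepSound : Structure → OneStepRule → Set₁
  OneStepSound 𝒯 R =
    ∀ (C : Set) (τ : SVar → Pred C 0ℓ) →
    All (τ ⊨_) (premises (schema R)) →
    (λ (♥ · ps) → ⟦ ♥ ⟧ (Vec.map τ ps)) ⊨ conclusion (schema R)
    where open Structure 𝒯

  ----------------------------------------------------------------------
  -- Absorption of multicut

  renameAtom : (SVar → SVar) → Atom → Atom
  renameAtom ρ (♥ · ps) = ♥ · Vec.map ρ ps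

  renameSchema : (SVar → SVar) → Schema → Schema
  renameSchema ρ (Ps / S) = map (mapSequent ρ) Ps / mapSequent (renameAtom ρ) S

  module _ {ℓ : Level} (𝓡 : Pred OneStepRule ℓ) where

    -- Rules are schematic: they are compared up to a change of schematic
    -- variables.  Distinct variables may be identified, and have to be for
    -- (♥ p)^m with m > 1 to occur in the conclusion of a rule, as each variable
    -- occurs at most once in the conclusion of a member of 𝓡.

    data Instance : Pred Schema ℓ where
      inst : ∀ {R} → R ∈ₚ 𝓡 → (ρ : SVar → SVar) →
             renameSchema ρ (schema R) ∈ₚ Instance

    AbsorbsMulticut : Set ℓ
    AbsorbsMulticut =
      ∀ {R₁ R₂} → R₁ ∈ₚ Instance → R₂ ∈ₚ Instance →
      ∀ {Γ₁ Δ₁ Γ₂ Δ₂} (♥p : Atom) {m n} → 1 ≤ m → 1 ≤ n →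
      conclusion R₁ ≋ (Γ₁ ⇒ Δ₁ ++ replicate m ♥p) →
      conclusion R₂ ≋ (replicate n ♥p ++ Γ₂ ⇒ Δ₂) →
      ∃[ R ] R ∈ₚ Instance
        × (MCut (_∈ premises R₁ ++ premises R₂) ▷ (_∈ premises R))
        × (｛ conclusion R ｝ ▷ ｛ Γ₁ ++ Γ₂ ⇒ Δ₁ ++ Δ₂ ｝)

  ----------------------------------------------------------------------
  -- The sequent system

  -- The substitution σ and the modal formulas of an application of S(R) both
  -- come from one assignment τ of bodies to schematic variables; as each
  -- variable occurs at most once in the conclusion of R, the bodies φᵢʲ can
  -- still be chosen independently of each other.

  modalAt : Name → (SVar → Formula 1) → Atom → Formula 0
  modalAt z τ (♥ · ps) = modal (free z) ♥ (Vec.map τ ps)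

  module _ {ℓ : Level} (𝓡 : Pred OneStepRule ℓ) (X : Rule₂ (Formula 0)) where

    -- Sequents derivable in S𝓡 extended with the two-premise rule X.

    data Derivable : Pred (Sequent (Formula 0)) ℓ where
      exchange : ∀ {S S′} → S ≋ S′ → Derivable S → Derivable S′

      ax       : ∀ {φ} → Derivable (φ ∷ [] ⇒ φ ∷ [])
      ⊥L       : Derivable (⊥ᶠ ∷ [] ⇒ [])
      ≈R       : ∀ {x} → Derivable ([] ⇒ free x ≈ free x ∷ [])

      ⊃R       : ∀ {Γ Δ φ ψ} →
                 Derivable (φ ∷ Γ ⇒ ψ ∷ Δ) →
                 Derivable (Γ ⇒ φ ⊃ ψ ∷ Δ)
      ⊃L       : ∀ {Γ Δ φ ψ} →
                 Derivable (Γ ⇒ φ ∷ Δ) → Derivable (ψ ∷ Γ ⇒ Δ) →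
                 Derivable (φ ⊃ ψ ∷ Γ ⇒ Δ)

      ∀R       : ∀ {Γ Δ φ y} → y FreshFor (Γ ⇒ ∀ᶠ φ ∷ Δ) →
                 Derivable (Γ ⇒ φ ⟨ y ⟩ ∷ Δ) →
                 Derivable (Γ ⇒ ∀ᶠ φ ∷ Δ)
      ∀L       : ∀ {Γ Δ φ z} →
                 Derivable (φ ⟨ z ⟩ ∷ Γ ⇒ Δ) →
                 Derivable (∀ᶠ φ ∷ Γ ⇒ Δ)

      ≈L₁      : ∀ {Γ Δ x y z} →
                 Derivable (free x ≈ free y ∷ map (_[ x / z ]) Γ ⇒ map (_[ x / z ]) Δ) →
                 Derivable (free x ≈ free y ∷ map (_[ y / z ]) Γ ⇒ map (_[ y / z ]) Δ)
      ≈L₂      : ∀ {Γ Δ x y z} →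
                 Derivable (free x ≈ free y ∷ map (_[ y / z ]) Γ ⇒ map (_[ y / z ]) Δ) →
                 Derivable (free x ≈ free y ∷ map (_[ x / z ]) Γ ⇒ map (_[ x / z ]) Δ)

      weakenL  : ∀ {Γ Δ φ} → Derivable (Γ ⇒ Δ) → Derivable (φ ∷ Γ ⇒ Δ)
      weakenR  : ∀ {Γ Δ φ} → Derivable (Γ ⇒ Δ) → Derivable (Γ ⇒ φ ∷ Δ)
      contrL   : ∀ {Γ Δ φ} → Derivable (φ ∷ φ ∷ Γ ⇒ Δ) → Derivable (φ ∷ Γ ⇒ Δ)
      contrR   : ∀ {Γ Δ φ} → Derivable (Γ ⇒ φ ∷ φ ∷ Δ) → Derivable (Γ ⇒ φ ∷ Δ)

      step     : ∀ {R Σ′ Θ} → R ∈ₚ 𝓡 →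
                 (τ : SVar → Formula 1) (z y : Name) →
                 let σ      = λ p → τ p ⟨ y ⟩
                     C      = mapSequent (modalAt z τ) (conclusion (schema R))
                     result = Σ′ ++ ante C ⇒ succ C ++ Θ
                 in y FreshFor result →
                    All (λ P → Derivable (Σ′ ++ map σ (ante P) ⇒ map σ (succ P) ++ Θ))
                        (premises (schema R)) →
                    Derivable result

      extra    : ∀ {S₁ S₂ S} → X S₁ S₂ S → Derivable S₁ → Derivable S₂ → Derivable S

-- Cut elimination is carried out in an auxiliary calculus _⟹_, in which principal formulas
-- persist and are matched up to the equations in the antecedent, so that no equality rule
-- has to be permuted with a cut.  Cuts are removed by induction on the size of the cut
-- formula and on the two derivations.
--
-- When the cut formula is principal in two modal inferences, absorption yields a rule with
-- the desired conclusion, each premise of which arises by one multicut from premises of the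
-- given rules.  The variable of that multicut need not be an argument of the cut formula: it
-- may be another variable of one of the two rules, standing for a formula of any size.  In
-- _⟹_ a modal inference therefore has to provide all propositional consequences of the
-- premises of its rule.  For derivations in S𝓡 these are obtained by cuts, which are
-- admissible in _⟹_ already; and in the principal case, once the arguments of the cut
-- formula are decided by cuts of smaller size, every consequence of the premises of both
-- rules is a consequence of the premises of one of them, since the rules share no other
-- variable.

module Submission where

open import Defs
open import Level using (Level)
open import Data.Product using (_×_)
open import Relation.Unary using (Pred; _∈_; _⊆_)

open import Data.Bool using (Bool; true; false)
import Data.Bool as Bool
open import Data.Empty using (⊥-elim)
open import Data.Fin using (zero; suc; toℕ)
open import Data.List using (List; []; _∷_; _++_; map; concatMap; replicate; length; filter)
open import Data.List.Properties
  using (map-cong; map-cong-local; map-∘; map-id; map-++; concatMap-++)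
open import Data.List.Membership.Propositional using (_∉_; find; lose) renaming (_∈_ to _∈ˡ_)
open import Data.List.Membership.Propositional.Properties
  using ( ∈-++⁺ˡ; ∈-++⁺ʳ; ∈-++⁻; ∈-map⁺; ∈-map⁻; ∈-concatMap⁺; ∈-concatMap⁻; ∈-∃++
        ; ∈-filter⁺; ∈-filter⁻)
open import Data.List.Relation.Binary.Permutation.Propositional as ↭
  using (_↭_; ↭-sym; ↭-trans; ↭-refl)
open import Data.List.Relation.Binary.Permutation.Propositional.Properties
  using (∈-resp-↭; All-resp-↭; shift; shifts; ++⁺ˡ; ++-comm)
  renaming (map⁺ to ↭-map⁺)
import Data.List.Relation.Binary.Permutation.Setoid.Properties as Setoid↭
open import Data.List.Relation.Binary.Subset.Propositional using () renaming (_⊆_ to _⊆ˡ_)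
open import Data.List.Relation.Binary.Subset.Propositional.Properties
  using (∷⁺ʳ) renaming (map⁺ to ⊆-map⁺)
open import Data.List.Relation.Unary.All as All using (All; []; _∷_)
import Data.List.Relation.Unary.All.Properties as All
open import Data.List.Relation.Unary.AllPairs using ([]; _∷_)
open import Data.List.Relation.Unary.Any as Any using (Any; here; there)
import Data.List.Relation.Unary.Any.Properties as Any
open import Data.List.Relation.Unary.Unique.Propositional using (Unique)
open import Data.Nat using (ℕ; zero; suc; _+_; _<_; _≤_; _≟_; z≤n; s≤s)
import Data.Nat.Properties as ℕ
open import Data.List.Membership.DecPropositional _≟_ using (_∈?_)
open import Data.Product using (∃; ∃-syntax; _,_; proj₁; proj₂)
open import Data.Sum using (_⊎_; inj₁; inj₂; [_,_]′)
open import Data.Vec using (Vec; []; _∷_; toList)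
import Data.Vec as Vec
import Data.Vec.Properties as Vec
open import Data.Vec.Relation.Binary.Pointwise.Inductive using (Pointwise; []; _∷_)
open import Function using (_∘_; id; const; case_of_)
open import Relation.Binary.PropositionalEquality
  using (_≡_; _≢_; refl; sym; trans; cong; cong₂; subst; subst₂; _≗_; setoid)
open import Relation.Nullary using (¬_; Dec; yes; no; contradiction; ¬?; _×-dec_; _⊎-dec_)

-- Renamings of free variables

_[_↦_] : {A : Set} → (ℕ → A) → ℕ → A → ℕ → A
(f [ x ↦ t ]) a with a ≟ x
... | yes _ = t
... | no  _ = f a

↦-here : {A : Set} (f : ℕ → A) (x : ℕ) {t : A} → (f [ x ↦ t ]) x ≡ t
↦-here f x with x ≟ x
... | yes _  = refl
... | no x≢x = contradiction refl x≢x

↦-there : {A : Set} (f : ℕ → A) {x a : ℕ} {t : A} → a ≢ x → (f [ x ↦ t ]) a ≡ f a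
↦-there f {x} {a} a≢x with a ≟ x
... | yes a≡x = contradiction a≡x a≢x
... | no _    = refl

fresh : (xs : List Name) → ∃[ y ] y ∉ xs
fresh xs = suc (bound xs) , λ y∈ → ℕ.<-irrefl refl (≤bound y∈)
  where
  bound : List Name → ℕ
  bound []       = 0
  bound (x ∷ xs) = x + bound xs

  ≤bound : ∀ {y xs} → y ∈ˡ xs → y ≤ bound xs
  ≤bound {xs = x ∷ xs} (here refl) = ℕ.m≤m+n x _
  ≤bound {xs = x ∷ xs} (there y∈)  = ℕ.≤-trans (≤bound y∈) (ℕ.m≤n+m _ x)

unique-++⁻ : ∀ {A : Set} (xs : List A) {ys} → Unique (xs ++ ys) →
             Unique xs × Unique ys × All (λ x → All (x ≢_) ys) xs
unique-++⁻ []       u        = [] , u , []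
unique-++⁻ (x ∷ xs) (x∉ ∷ u) with u₁ , u₂ , d ← unique-++⁻ xs u =
  All.++⁻ˡ xs x∉ ∷ u₁ , u₂ , All.++⁻ʳ xs x∉ ∷ d

unique-↭ : ∀ {A : Set} {xs ys : List A} → xs ↭ ys → Unique xs → Unique ys
unique-↭ {A} p = Setoid↭.Unique-resp-↭ (setoid A) (↭.↭⇒↭ₛ p)

concatMap-↭ : ∀ {A B : Set} (f : A → List B) {xs ys} → xs ↭ ys → concatMap f xs ↭ concatMap f ys
concatMap-↭ f ↭.refl          = ↭-refl
concatMap-↭ f (↭.prep x p)    = ++⁺ˡ (f x) (concatMap-↭ f p)
concatMap-↭ f (↭.swap x y p)  =
  ↭-trans (shifts (f x) (f y)) (++⁺ˡ (f y) (++⁺ˡ (f x) (concatMap-↭ f p)))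
concatMap-↭ f (↭.trans p q)   = ↭-trans (concatMap-↭ f p) (concatMap-↭ f q)

-- Propositional reasoning about schematic variables

Valuation : Set
Valuation = SVar → Bool

Refutes : Valuation → Sequent SVar → Set
Refutes v (Γ ⇒ Δ) = All (λ p → v p ≡ true) Γ × All (λ p → v p ≡ false) Δ

infix 4 _⊩_

-- Sequents over schematic variables are read as clauses. This semantic consequence stands for
-- propositional derivability from `Ps`, with any number of cuts.
_⊩_ : List (Sequent SVar) → Sequent SVar → Set
Ps ⊩ P = ∀ v → Refutes v P → Any (Refutes v) Ps

refutes? : ∀ v P → Dec (Refutes v P)
refutes? v (Γ ⇒ Δ) = All.all? (λ p → v p Bool.≟ true) Γ ×-dec All.all? (λ p → v p Bool.≟ false) Δ

refutes-⊑ : ∀ {v P Q} → P ⊑ Q → Refutes v Q → Refutes v P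
refutes-⊑ {P = Π ⇒ Σ′} ((_ , p) , (_ , q)) (ts , fs) =
  All.++⁻ˡ Π (All-resp-↭ (↭-sym p) ts) , All.++⁻ˡ Σ′ (All-resp-↭ (↭-sym q) fs)

refutes-≋ : ∀ {v P Q} → P ≋ Q → Refutes v Q → Refutes v P
refutes-≋ (p , q) (ts , fs) = All-resp-↭ (↭-sym p) ts , All-resp-↭ (↭-sym q) fs

-- The value of the cut variable decides which premise fails: true refutes the one with copies on
-- the left, false the other.
refutes-Mcut : ∀ {v P₁ P₂ P} → Mcut P₁ P₂ P → Refutes v P → Refutes v P₁ ⊎ Refutes v P₂
refutes-Mcut {v} (mcut Γ Δ Σ′ Θ φ {m} {n} _ _) (ts , fs) with v φ in eq
... | true  = inj₂ (All.++⁺ (All.replicate⁺ n eq) (All.++⁻ʳ Γ ts) , All.++⁻ʳ Δ fs)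
... | false = inj₁ (All.++⁻ˡ Γ ts , All.++⁺ (All.++⁻ˡ Δ fs) (All.replicate⁺ m eq))

refutes-MCut : ∀ {v Ps P} → P ∈ MCut (_∈ˡ Ps) → Refutes v P → Any (Refutes v) Ps
refutes-MCut (none P∈) r = lose P∈ r
refutes-MCut (one P₁∈ P₂∈ e₁ e₂ c) r with refutes-Mcut c r
... | inj₁ r₁ = lose P₁∈ (refutes-≋ e₁ r₁)
... | inj₂ r₂ = lose P₂∈ (refutes-≋ e₂ r₂)

-- Multicut and weakening are propositionally sound, so what follows from the premises of the
-- absorbing rule follows from those of the two given rules.
▷⇒⊩ : ∀ {Ps Qs P} → MCut (_∈ˡ Ps) ▷ (_∈ˡ Qs) → Qs ⊩ P → Ps ⊩ P
▷⇒⊩ cover e v r with _ , Q∈ , rQ ← find (e v r) with _ , S∈ , S⊑Q ← cover Q∈ =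
  refutes-MCut S∈ (refutes-⊑ S⊑Q rQ)

⊩-map : ∀ ρ {Ps P} → Ps ⊩ P → map (mapSequent ρ) Ps ⊩ mapSequent ρ P
⊩-map ρ e v (ts , fs) =
  Any.map⁺ (Any.map (λ { (ts , fs) → All.map⁺ ts , All.map⁺ fs })
    (e (v ∘ ρ) (All.map⁻ ts , All.map⁻ fs)))

∈⇒⊩ : ∀ {Ps P} → P ∈ˡ Ps → Ps ⊩ P
∈⇒⊩ P∈ v r = lose P∈ r

infix 4 _⊆ˢ_

_⊆ˢ_ : {A : Set} → Sequent A → Sequent A → Set
S ⊆ˢ S′ = ante S ⊆ˡ ante S′ × succ S ⊆ˡ succ S′

refutes-⊆ : ∀ {v P Q} → P ⊆ˢ Q → Refutes v Q → Refutes v P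
refutes-⊆ (s , t) (ts , fs) = All.anti-mono s ts , All.anti-mono t fs

varsOf : List (Sequent SVar) → List SVar
varsOf = concatMap (λ P → ante P ++ succ P)

refutes-agree : ∀ {v w} P → (∀ {p} → p ∈ˡ ante P ++ succ P → v p ≡ w p) → Refutes v P → Refutes w P
refutes-agree (Γ ⇒ Δ) h (ts , fs) =
    All.tabulate (λ m → trans (sym (h (∈-++⁺ˡ m))) (All.lookup ts m))
  , All.tabulate (λ m → trans (sym (h (∈-++⁺ʳ Γ m))) (All.lookup fs m))

any-refutes-agree : ∀ {v w} Ps → (∀ {p} → p ∈ˡ varsOf Ps → v p ≡ w p) →
                    Any (Refutes v) Ps → Any (Refutes w) Ps
any-refutes-agree (P ∷ Ps) h (here r)  = here (refutes-agree P (h ∘ ∈-++⁺ˡ) r)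
any-refutes-agree (P ∷ Ps) h (there r) =
  there (any-refutes-agree Ps (h ∘ ∈-++⁺ʳ (ante P ++ succ P)) r)

-- `Q` depends only on the values at the finitely many variables `xs`, so trying both truth values
-- at each of them settles the question.
search : {Q : Valuation → Set} (xs : List SVar) → (∀ v → Dec (Q v)) →
         (∀ {v w} → (∀ {x} → x ∈ˡ xs → v x ≡ w x) → Q v → Q w) →
         ∃ Q ⊎ (∀ v → ¬ Q v)
-- No variable is left to matter, so one arbitrary valuation represents all of them.
search [] Q? ext with Q? (const true)
... | yes q = inj₁ (_ , q)
... | no ¬q = inj₂ λ v q → ¬q (ext (λ ()) q)
search {Q} (x ∷ xs) Q? ext = decide (try true) (try false)
  where
  agree : ∀ {v w b} → (∀ {y} → y ∈ˡ xs → v y ≡ w y) →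
          ∀ {y} → y ∈ˡ x ∷ xs → (v [ x ↦ b ]) y ≡ (w [ x ↦ b ]) y
  agree {v} {w} h {y} m with y ≟ x
  agree h m           | yes _  = refl
  agree h (here refl) | no x≢x = contradiction refl x≢x
  agree h (there m)   | no _   = h m

  try : ∀ b → ∃ (λ v → Q (v [ x ↦ b ])) ⊎ (∀ v → ¬ Q (v [ x ↦ b ]))
  try b = search xs (λ v → Q? (v [ x ↦ b ])) (λ h → ext (agree h))

  restore : ∀ v {y} → v y ≡ (v [ x ↦ v x ]) y
  restore v {y} with y ≟ x
  ... | yes refl = refl
  ... | no _     = refl

  decide : _ → _ → _
  decide (inj₁ (v , q)) _ = inj₁ (_ , q)
  decide (inj₂ _) (inj₁ (v , q)) = inj₁ (_ , q)
  decide (inj₂ ¬t) (inj₂ ¬f) = inj₂ λ v q → case-on v (v x) refl (ext (λ _ → restore v) q)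
    where
    case-on : ∀ v b → v x ≡ b → ¬ Q (v [ x ↦ v x ])
    case-on v true  eq q = ¬t v (subst (λ b → Q (v [ x ↦ b ])) eq q)
    case-on v false eq q = ¬f v (subst (λ b → Q (v [ x ↦ b ])) eq q)

Tautology : Sequent SVar → Set
Tautology K = Any (_∈ˡ succ K) (ante K)

tautology? : ∀ K → Dec (Tautology K)
tautology? K = Any.any? (_∈? succ K) (ante K)

Decided : SVar → Sequent SVar → Set
Decided x K = x ∈ˡ ante K ⊎ x ∈ˡ succ K

decided? : ∀ x K → Dec (Decided x K)
decided? x K = (x ∈? ante K) ⊎-dec (x ∈? succ K)

-- Literals of `K` take precedence, left before right, and `u` fills in the undecided variables. The
-- order of the sides is immaterial unless `K` is a tautology.
countermodel : Sequent SVar → Valuation → Valuation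
countermodel K u x with x ∈? ante K
... | yes _ = true
... | no _ with x ∈? succ K
...   | yes _ = false
...   | no _  = u x

countermodel-refutes : ∀ {K} u → ¬ Tautology K → Refutes (countermodel K u) K
countermodel-refutes {K} u ¬taut = All.tabulate holds , All.tabulate fails
  where
  holds : ∀ {x} → x ∈ˡ ante K → countermodel K u x ≡ true
  holds {x} x∈ with x ∈? ante K
  ... | yes _ = refl
  ... | no x∉ = contradiction x∈ x∉

  fails : ∀ {x} → x ∈ˡ succ K → countermodel K u x ≡ false
  fails {x} x∈ with x ∈? ante K
  ... | yes x∈′ = contradiction (lose x∈′ x∈) ¬taut
  ... | no _ with x ∈? succ K
  ...   | yes _ = refl
  ...   | no x∉ = contradiction x∈ x∉

countermodel-undecided : ∀ {K x} u → ¬ Decided x K → countermodel K u x ≡ u x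
countermodel-undecided {K} {x} u ¬d with x ∈? ante K
... | yes x∈ = contradiction (inj₁ x∈) ¬d
... | no _ with x ∈? succ K
...   | yes x∈ = contradiction (inj₂ x∈) ¬d
...   | no _   = refl

-- If K is no tautology, its literals determine a valuation that refutes P and hence some
-- member of Ps, all of whose literals are therefore in K.
member-or-tautology : ∀ {Ps P K} → Ps ⊩ P → P ⊆ˢ K → (∀ {x} → x ∈ˡ varsOf Ps → Decided x K) →
                      Any (_⊆ˢ K) Ps ⊎ Tautology K
member-or-tautology {Ps} {P} {K} e P⊆K decided with tautology? K
... | yes taut = inj₂ taut
... | no ¬taut = inj₁ (included Ps decided (e v (refutes-⊆ P⊆K r)))
  where
  v : Valuation
  v = countermodel K (const true)

  r : Refutes v K
  r = countermodel-refutes (const true) ¬taut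

  true∈ : ∀ {x} → Decided x K → v x ≡ true → x ∈ˡ ante K
  true∈ (inj₁ x∈) _ = x∈
  true∈ (inj₂ x∈) t = case trans (sym t) (All.lookup (proj₂ r) x∈) of λ ()

  false∈ : ∀ {x} → Decided x K → v x ≡ false → x ∈ˡ succ K
  false∈ (inj₁ x∈) f = case trans (sym f) (All.lookup (proj₁ r) x∈) of λ ()
  false∈ (inj₂ x∈) _ = x∈

  included : ∀ Qs → (∀ {x} → x ∈ˡ varsOf Qs → Decided x K) → Any (Refutes v) Qs → Any (_⊆ˢ K) Qs
  included (Q ∷ Qs) d (here (ts , fs)) =
    here ((λ m → true∈ (d (∈-++⁺ˡ (∈-++⁺ˡ m))) (All.lookup ts m)) ,
          (λ m → false∈ (d (∈-++⁺ˡ (∈-++⁺ʳ (ante Q) m))) (All.lookup fs m)))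
  included (Q ∷ Qs) d (there i) = there (included Qs (d ∘ ∈-++⁺ʳ (ante Q ++ succ Q)) i)

-- Three disjoint copies of the schematic variables: for the arguments of the cut atom and
-- for the other variables of the two rules, which have to be kept apart.

data Origin : Set where
  argument left right : Origin

-- Variable n of copy i, for i = 0, 1, 2, is coded as 3n + i.
encode : Origin → ℕ → SVar
encode argument zero    = 0
encode left     zero    = 1
encode right    zero    = 2
encode o        (suc n) = 3 + encode o n

decode : SVar → Origin × ℕ
decode 0 = argument , 0
decode 1 = left , 0
decode 2 = right , 0
decode (suc (suc (suc x))) with o , n ← decode x = o , suc n

decode-encode : ∀ o n → decode (encode o n) ≡ (o , n)
decode-encode argument zero = refl
decode-encode left     zero = refl
decode-encode right    zero = refl
decode-encode argument (suc n) rewrite decode-encode argument n = refl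
decode-encode left     (suc n) rewrite decode-encode left n = refl
decode-encode right    (suc n) rewrite decode-encode right n = refl

-- Here `K₁` lives over the variables of the rule before renaming, because the premises of the rule
-- are given in these.
Pullback : (SVar → SVar) → List (Sequent SVar) → Sequent SVar → Set
Pullback ρ Ps K = ∃[ K₁ ] Ps ⊩ K₁ × mapSequent ρ K₁ ⊆ˢ K

-- A model of `Ps` which, wherever `ρ` leads into `K`, takes the value needed to refute `K`.
Compatible : (SVar → SVar) → List (Sequent SVar) → Sequent SVar → Valuation → Set
Compatible ρ Ps K v =
  (∀ p → p ∈ˡ varsOf Ps → (ρ p ∈ˡ ante K → v p ≡ true) × (ρ p ∈ˡ succ K → v p ≡ false)) ×
  ¬ Any (Refutes v) Ps

-- Let `K₁` collect the variables of `Ps` that `ρ` sends into `K`, on the corresponding sides.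
-- Either `Ps ⊩ K₁`, or the search finds a valuation refuting `K₁` and no member of `Ps`.
pullback-or-compatible : ∀ ρ Ps K → Pullback ρ Ps K ⊎ ∃ (Compatible ρ Ps K)
pullback-or-compatible ρ Ps K =
  [ (λ (v , r , ¬r) → inj₂ (v , compatible r , ¬r))
  , (λ never → inj₁ (K₁ , entails never , sub))
  ]′ (search vs Q? ext)
  where
  vs : List SVar
  vs = varsOf Ps

  inAnte? : ∀ p → Dec (ρ p ∈ˡ ante K)
  inAnte? p = ρ p ∈? ante K

  inSucc? : ∀ p → Dec (ρ p ∈ˡ succ K)
  inSucc? p = ρ p ∈? succ K

  K₁ : Sequent SVar
  K₁ = filter inAnte? vs ⇒ filter inSucc? vs

  Q : Valuation → Set
  Q v = Refutes v K₁ × ¬ Any (Refutes v) Ps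

  any? : ∀ v → Dec (Any (Refutes v) Ps)
  any? v = Any.any? (refutes? v) Ps

  Q? : ∀ v → Dec (Q v)
  Q? v = refutes? v K₁ ×-dec ¬? (any? v)

  ext : ∀ {v w} → (∀ {x} → x ∈ˡ vs → v x ≡ w x) → Q v → Q w
  ext h (r , ¬r) =
      refutes-agree K₁ (λ m → h ([ proj₁ ∘ ∈-filter⁻ inAnte? , proj₁ ∘ ∈-filter⁻ inSucc? ]′
                                   (∈-++⁻ (ante K₁) m))) r
    , λ r′ → ¬r (any-refutes-agree Ps (sym ∘ h) r′)

  compatible : ∀ {v} → Refutes v K₁ → ∀ p → p ∈ˡ vs →
               (ρ p ∈ˡ ante K → v p ≡ true) × (ρ p ∈ˡ succ K → v p ≡ false)
  compatible (ts , fs) p m = (λ i → All.lookup ts (∈-filter⁺ inAnte? m i))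
                         , (λ i → All.lookup fs (∈-filter⁺ inSucc? m i))

  entails : (∀ v → ¬ Q v) → Ps ⊩ K₁
  entails never v r with any? v
  ... | yes a = a
  ... | no ¬a = contradiction (r , ¬a) (never v)

  sub : mapSequent ρ K₁ ⊆ˢ K
  sub = (λ m → case ∈-map⁻ ρ m of λ { (_ , p∈ , refl) → proj₂ (∈-filter⁻ inAnte? {xs = vs} p∈) })
      , (λ m → case ∈-map⁻ ρ m of λ { (_ , p∈ , refl) → proj₂ (∈-filter⁻ inSucc? {xs = vs} p∈) })

Tagged : Origin → (SVar → SVar) → List SVar → Set
Tagged o ρ qs = ∀ p → ρ p ≡ encode o p ⊎ ρ p ∈ˡ qs

-- Two rules that share only the variables qs: once these are decided, valuations for the
-- remaining variables of either rule can be combined.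
interpolate : ∀ {ρ₁ ρ₂ qs Ps₁ Ps₂ K} → Tagged left ρ₁ qs → Tagged right ρ₂ qs →
              map (mapSequent ρ₁) Ps₁ ++ map (mapSequent ρ₂) Ps₂ ⊩ K →
              (∀ {q} → q ∈ˡ qs → Decided q K) → ¬ Tautology K →
              Pullback ρ₁ Ps₁ K ⊎ Pullback ρ₂ Ps₂ K
interpolate {ρ₁} {ρ₂} {qs} {Ps₁} {Ps₂} {K} t₁ t₂ e decided ¬taut
  with pullback-or-compatible ρ₁ Ps₁ K | pullback-or-compatible ρ₂ Ps₂ K
... | inj₁ pb | _ = inj₁ pb
... | inj₂ _  | inj₁ pb = inj₂ pb
... | inj₂ (v₁ , c₁) | inj₂ (v₂ , c₂) =
  ⊥-elim ([ satisfied {left} t₁ c₁ (λ p → cong choose (decode-encode left p)) ∘ Any.map⁻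
          , satisfied {right} t₂ c₂ (λ p → cong choose (decode-encode right p)) ∘ Any.map⁻ ]′
          (Any.++⁻ (map (mapSequent ρ₁) Ps₁) (e v r)))
  where
  choose : Origin × ℕ → Bool
  -- An arbitrary value: the shared variables are decided by `K`, which overrides `choose`.
  choose (argument , _) = true
  choose (left , p)     = v₁ p
  choose (right , p)    = v₂ p

  v : Valuation
  v = countermodel K (choose ∘ decode)

  r : Refutes v K
  r = countermodel-refutes (choose ∘ decode) ¬taut

  satisfied : ∀ {o ρ Ps w} → Tagged o ρ qs → Compatible ρ Ps K w →
              (∀ p → choose (decode (encode o p)) ≡ w p) →
              ¬ Any (λ P → Refutes v (mapSequent ρ P)) Ps
  satisfied {o} {ρ} {Ps} {w} tagged (compat , ¬r) chosen any =
    ¬r (any-refutes-agree Ps agree (Any.map (λ { (ts , fs) → All.map⁻ ts , All.map⁻ fs }) any))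
    where
    agree : ∀ {p} → p ∈ˡ varsOf Ps → v (ρ p) ≡ w p
    agree {p} m with decided? (ρ p) K
    ... | yes (inj₁ i) = trans (All.lookup (proj₁ r) i) (sym (proj₁ (compat p m) i))
    ... | yes (inj₂ i) = trans (All.lookup (proj₂ r) i) (sym (proj₂ (compat p m) i))
    -- An undecided variable is not shared, so it lies in the rule's own copy and has the value
    -- chosen for that rule.
    ... | no ¬d with tagged p
    ...   | inj₁ eq = trans (countermodel-undecided {K} _ ¬d)
                        (trans (cong (choose ∘ decode) eq) (chosen p))
    ...   | inj₂ q∈ = contradiction (decided q∈) ¬d

-- Functoriality of renaming, and its dependence on free names only.

module Renaming (𝒮 : Signature) where

  open Signature 𝒮
  open CPL 𝒮

  -- A named counterpart of the weakening local to `lift`, so that equations about `lift` can be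
  -- stated.
  weakenᵛ : ∀ {l} → Var l → Var (suc l)
  weakenᵛ (free a)  = free a
  weakenᵛ (bound i) = bound (suc i)

  lift-free : ∀ {k l} (f : Var k → Var l) a → lift f (free a) ≡ weakenᵛ (f (free a))
  lift-free f a with f (free a)
  ... | free _  = refl
  ... | bound _ = refl

  lift-bound : ∀ {k l} (f : Var k → Var l) i → lift f (bound (suc i)) ≡ weakenᵛ (f (bound i))
  lift-bound f i with f (bound i)
  ... | free _  = refl
  ... | bound _ = refl

  lift-weaken : ∀ {k l} (f : Var k → Var l) u → lift f (weakenᵛ u) ≡ weakenᵛ (f u)
  lift-weaken f (free a)  = lift-free f a
  lift-weaken f (bound i) = lift-bound f i

  lift-∘ : ∀ {k l m} (g : Var l → Var m) (f : Var k → Var l) → lift g ∘ lift f ≗ lift (g ∘ f)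
  lift-∘ g f (free a) =
    trans (cong (lift g) (lift-free f a)) (trans (lift-weaken g _) (sym (lift-free (g ∘ f) a)))
  lift-∘ g f (bound zero) = refl
  lift-∘ g f (bound (suc i)) =
    trans (cong (lift g) (lift-bound f i)) (trans (lift-weaken g _) (sym (lift-bound (g ∘ f) i)))

  lift-id : ∀ {k} {f : Var k → Var k} → f ≗ id → lift f ≗ id
  lift-id {f = f} f≗ (free a)        = trans (lift-free f a) (cong weakenᵛ (f≗ (free a)))
  lift-id         f≗ (bound zero)    = refl
  lift-id {f = f} f≗ (bound (suc i)) = trans (lift-bound f i) (cong weakenᵛ (f≗ (bound i)))

  -- Bound variables have no names, so agreement on them is demanded whatever `xs` is.
  AgreeOn : ∀ {k l} → List Name → (f g : Var k → Var l) → Set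
  AgreeOn xs f g = ∀ u → fvᵛ u ⊆ˡ xs → f u ≡ g u

  lift-agree : ∀ {k l xs} {f g : Var k → Var l} → AgreeOn xs f g → AgreeOn xs (lift f) (lift g)
  lift-agree {f = f} {g} h (free a) sub =
    trans (lift-free f a) (trans (cong weakenᵛ (h (free a) sub)) (sym (lift-free g a)))
  lift-agree h (bound zero) sub = refl
  lift-agree {f = f} {g} h (bound (suc i)) sub =
    trans (lift-bound f i) (trans (cong weakenᵛ (h (bound i) λ ())) (sym (lift-bound g i)))

  map-agree : ∀ {k l xs n} {f g : Var k → Var l} (us : Vec (Var k) n) →
              concatMap fvᵛ (toList us) ⊆ˡ xs → AgreeOn xs f g → Vec.map f us ≡ Vec.map g us
  map-agree []       sub h = refl
  map-agree (u ∷ us) sub h =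
    cong₂ _∷_ (h u (sub ∘ ∈-++⁺ˡ)) (map-agree us (sub ∘ ∈-++⁺ʳ (fvᵛ u)) h)

  mutual
    rename-agree : ∀ {k l xs} {f g : Var k → Var l} (φ : Formula k) →
                   fv φ ⊆ˡ xs → AgreeOn xs f g → rename f φ ≡ rename g φ
    rename-agree (u ≈ v) sub h =
      cong₂ _≈_ (h u (sub ∘ ∈-++⁺ˡ)) (h v (sub ∘ ∈-++⁺ʳ (fvᵛ u)))
    rename-agree (pred P us) sub h = cong (pred P) (map-agree us sub h)
    rename-agree ⊥ᶠ sub h = refl
    rename-agree (φ ⊃ ψ) sub h =
      cong₂ _⊃_ (rename-agree φ (sub ∘ ∈-++⁺ˡ) h) (rename-agree ψ (sub ∘ ∈-++⁺ʳ (fv φ)) h)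
    rename-agree (∀ᶠ φ) sub h = cong ∀ᶠ (rename-agree φ sub (lift-agree h))
    rename-agree (modal u ♥ φs) sub h =
      cong₂ (λ v → modal v ♥) (h u (sub ∘ ∈-++⁺ˡ))
        (renames-agree φs (sub ∘ ∈-++⁺ʳ (fvᵛ u)) (lift-agree h))

    renames-agree : ∀ {k l xs n} {f g : Var k → Var l} (φs : Vec (Formula k) n) →
                    fvs φs ⊆ˡ xs → AgreeOn xs f g → renames f φs ≡ renames g φs
    renames-agree []       sub h = refl
    renames-agree (φ ∷ φs) sub h =
      cong₂ _∷_ (rename-agree φ (sub ∘ ∈-++⁺ˡ) h) (renames-agree φs (sub ∘ ∈-++⁺ʳ (fv φ)) h)

  rename-cong : ∀ {k l} {f g : Var k → Var l} → f ≗ g → rename f ≗ rename g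
  rename-cong f≗g φ = rename-agree φ id (λ u _ → f≗g u)

  renames-cong : ∀ {k l n} {f g : Var k → Var l} → f ≗ g →
                 renames {n = n} f ≗ renames g
  renames-cong f≗g φs = renames-agree φs id (λ u _ → f≗g u)

  mutual
    rename-∘ : ∀ {k l m} (g : Var l → Var m) (f : Var k → Var l) →
               rename g ∘ rename f ≗ rename (g ∘ f)
    rename-∘ g f (u ≈ v)     = refl
    rename-∘ g f (pred P us) = cong (pred P) (sym (Vec.map-∘ g f us))
    rename-∘ g f ⊥ᶠ          = refl
    rename-∘ g f (φ ⊃ ψ)     = cong₂ _⊃_ (rename-∘ g f φ) (rename-∘ g f ψ)
    rename-∘ g f (∀ᶠ φ)      =
      cong ∀ᶠ (trans (rename-∘ (lift g) (lift f) φ) (rename-cong (lift-∘ g f) φ))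
    rename-∘ g f (modal u ♥ φs) =
      cong (modal _ ♥) (trans (renames-∘ (lift g) (lift f) φs) (renames-cong (lift-∘ g f) φs))

    renames-∘ : ∀ {k l m n} (g : Var l → Var m) (f : Var k → Var l) (φs : Vec (Formula k) n) →
                renames g (renames f φs) ≡ renames (g ∘ f) φs
    renames-∘ g f []       = refl
    renames-∘ g f (φ ∷ φs) = cong₂ _∷_ (rename-∘ g f φ) (renames-∘ g f φs)

  mutual
    rename-id : ∀ {k} {f : Var k → Var k} → f ≗ id → rename f ≗ id
    rename-id f≗ (u ≈ v)        = cong₂ _≈_ (f≗ u) (f≗ v)
    rename-id f≗ (pred P us)    = cong (pred P) (trans (Vec.map-cong f≗ us) (Vec.map-id us))
    rename-id f≗ ⊥ᶠ             = refl
    rename-id f≗ (φ ⊃ ψ)        = cong₂ _⊃_ (rename-id f≗ φ) (rename-id f≗ ψ)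
    rename-id f≗ (∀ᶠ φ)         = cong ∀ᶠ (rename-id (lift-id f≗) φ)
    rename-id f≗ (modal u ♥ φs) = cong₂ (λ v → modal v ♥) (f≗ u) (renames-id (lift-id f≗) φs)

    renames-id : ∀ {k n} {f : Var k → Var k} → f ≗ id → (φs : Vec (Formula k) n) →
                 renames f φs ≡ φs
    renames-id f≗ []       = refl
    renames-id f≗ (φ ∷ φs) = cong₂ _∷_ (rename-id f≗ φ) (renames-id f≗ φs)

  renames≡map : ∀ {k l n} (f : Var k → Var l) (φs : Vec (Formula k) n) →
                renames f φs ≡ Vec.map (rename f) φs
  renames≡map f []       = refl
  renames≡map f (φ ∷ φs) = cong (rename f φ ∷_) (renames≡map f φs)

  -- Size of formulas.

  mutual
    -- Variables do not count, so renaming a formula or instantiating a body preserves its size.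
    size : ∀ {k} → Formula k → ℕ
    size (u ≈ v)        = 0
    size (pred P us)    = 0
    size ⊥ᶠ             = 0
    size (φ ⊃ ψ)        = suc (size φ + size ψ)
    size (∀ᶠ φ)         = suc (size φ)
    size (modal u ♥ φs) = suc (sizes φs)

    sizes : ∀ {k n} → Vec (Formula k) n → ℕ
    sizes []       = 0
    sizes (φ ∷ φs) = size φ + sizes φs

  mutual
    size-rename : ∀ {k l} (f : Var k → Var l) (φ : Formula k) → size (rename f φ) ≡ size φ
    size-rename f (u ≈ v)        = refl
    size-rename f (pred P us)    = refl
    size-rename f ⊥ᶠ             = refl
    size-rename f (φ ⊃ ψ)        = cong suc (cong₂ _+_ (size-rename f φ) (size-rename f ψ))
    size-rename f (∀ᶠ φ)         = cong suc (size-rename (lift f) φ)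
    size-rename f (modal u ♥ φs) = cong suc (sizes-renames (lift f) φs)

    sizes-renames : ∀ {k l n} (f : Var k → Var l) (φs : Vec (Formula k) n) →
                    sizes (renames f φs) ≡ sizes φs
    sizes-renames f []       = refl
    sizes-renames f (φ ∷ φs) = cong₂ _+_ (size-rename f φ) (sizes-renames f φs)

  -- Renamings that act on names and fix bound variables.

  onFree : (Name → Name) → ∀ {k} → Var k → Var k
  onFree f (free a)  = free (f a)
  onFree f (bound i) = bound i

  ren : (Name → Name) → ∀ {k} → Formula k → Formula k
  ren f = rename (onFree f)

  lift-onFree : ∀ f {k} → lift (onFree f {k}) ≗ onFree f
  lift-onFree f (free a)        = lift-free (onFree f) a
  lift-onFree f (bound zero)    = refl
  lift-onFree f (bound (suc i)) = lift-bound (onFree f) i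

  ren-∀ : ∀ f {k} (φ : Formula (suc k)) → ren f (∀ᶠ φ) ≡ ∀ᶠ (ren f φ)
  ren-∀ f φ = cong ∀ᶠ (rename-cong (lift-onFree f) φ)

  ren-modal : ∀ f {k} (u : Var k) ♥ φs →
              ren f (modal u ♥ φs) ≡ modal (onFree f u) ♥ (Vec.map (ren f) φs)
  ren-modal f u ♥ φs =
    cong (modal _ ♥) (trans (renames-cong (lift-onFree f) φs) (renames≡map (onFree f) φs))

  ren-cong : ∀ {f g : Name → Name} {k} (φ : Formula k) →
             (∀ {a} → a ∈ˡ fv φ → f a ≡ g a) → ren f φ ≡ ren g φ
  ren-cong {f} {g} φ h = rename-agree φ id agree
    where
    agree : AgreeOn (fv φ) (onFree f) (onFree g)
    agree (free a)  sub = cong free (h (sub (here refl)))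
    agree (bound i) sub = refl

  ren-∘ : ∀ (g f : Name → Name) {k} (φ : Formula k) → ren g (ren f φ) ≡ ren (g ∘ f) φ
  ren-∘ g f φ = trans (rename-∘ (onFree g) (onFree f) φ)
    (rename-cong (λ { (free a) → refl ; (bound i) → refl }) φ)

  ren-id : ∀ {k} (φ : Formula k) → ren id φ ≡ φ
  ren-id = rename-id λ { (free a) → refl ; (bound i) → refl }

  size-ren : ∀ f {k} (φ : Formula k) → size (ren f φ) ≡ size φ
  size-ren f = size-rename (onFree f)

  size-⟨⟩ : ∀ (φ : Formula 1) y → size (φ ⟨ y ⟩) ≡ size φ
  size-⟨⟩ φ y = size-rename _ φ

  ren-⟨⟩ : ∀ f (φ : Formula 1) y → ren f (φ ⟨ y ⟩) ≡ ren f φ ⟨ f y ⟩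
  ren-⟨⟩ f φ y =
    trans (rename-∘ (onFree f) _ φ)
      (trans (rename-cong (λ { (free a) → refl ; (bound zero) → refl }) φ)
        (sym (rename-∘ _ (onFree f) φ)))

  -- Recovers the local function in the definition of _[_/_], which has no name of its own.
  substitution : ∀ {k} (φ : Formula k) t x → ∃[ f ] φ [ t / x ] ≡ rename f φ
  substitution φ t x = _ , refl

  [/]≡ren : ∀ {k} (φ : Formula k) t x → φ [ t / x ] ≡ ren (id [ x ↦ t ]) φ
  [/]≡ren φ t x = rename-cong agree φ
    where
    agree : proj₁ (substitution φ t x) ≗ onFree (id [ x ↦ t ])
    agree (free a) with a ≟ x
    ... | yes _ = refl
    ... | no  _ = refl
    agree (bound i) = refl

  ren-fresh : ∀ f {y y′ k} (φ : Formula k) → y ∉ fv φ → ren (f [ y ↦ y′ ]) φ ≡ ren f φ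
  ren-fresh f φ y∉ = ren-cong φ (λ a∈ → ↦-there f (λ { refl → y∉ a∈ }))

  ren-⟨fresh⟩ : ∀ f {y} y′ (φ : Formula 1) → y ∉ fv φ →
                ren (f [ y ↦ y′ ]) (φ ⟨ y ⟩) ≡ ren f φ ⟨ y′ ⟩
  ren-⟨fresh⟩ f {y} y′ φ y∉ =
    trans (ren-⟨⟩ _ φ y) (cong₂ _⟨_⟩ (ren-fresh f φ y∉) (↦-here f y))

  -- Equality and membership modulo the equations of an antecedent.

  Resp : (Name → Name) → List (Formula 0) → Set
  Resp f Γ = ∀ {a b} → (free a ≈ free b) ∈ˡ Γ → f a ≡ f b

  infix 4 _⊢_~_ _∈[_]_ _⊆[_]_ _≽_

  -- Equality modulo the equations in Γ, expressed by all renamings that solve them.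
  record _⊢_~_ (Γ : List (Formula 0)) {k} (φ ψ : Formula k) : Set where
    constructor mk~
    field
      under : ∀ f → Resp f Γ → ren f φ ≡ ren f ψ

  open _⊢_~_

  ~-refl : ∀ {Γ k} {φ : Formula k} → Γ ⊢ φ ~ φ
  ~-refl .under f r = refl

  ~-sym : ∀ {Γ k} {φ ψ : Formula k} → Γ ⊢ φ ~ ψ → Γ ⊢ ψ ~ φ
  ~-sym e .under f r = sym (e .under f r)

  ~-trans : ∀ {Γ k} {φ ψ χ : Formula k} → Γ ⊢ φ ~ ψ → Γ ⊢ ψ ~ χ → Γ ⊢ φ ~ χ
  ~-trans e e′ .under f r = trans (e .under f r) (e′ .under f r)

  ~-reflexive : ∀ {Γ k} {φ ψ : Formula k} → φ ≡ ψ → Γ ⊢ φ ~ ψ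
  ~-reflexive refl = ~-refl

  _≽_ : List (Formula 0) → List (Formula 0) → Set
  Γ′ ≽ Γ = ∀ {f} → Resp f Γ′ → Resp f Γ

  ~-mono : ∀ {Γ Γ′ k} {φ ψ : Formula k} → Γ′ ≽ Γ → Γ ⊢ φ ~ ψ → Γ′ ⊢ φ ~ ψ
  ~-mono Γ′≽Γ e .under f r = e .under f (Γ′≽Γ r)

  Resp-map : ∀ {f g Γ} → Resp g (map (ren f) Γ) → Resp (g ∘ f) Γ
  Resp-map {f} r m = r (∈-map⁺ (ren f) m)

  ~-ren : ∀ {Γ k} {φ ψ : Formula k} f → Γ ⊢ φ ~ ψ → map (ren f) Γ ⊢ ren f φ ~ ren f ψ
  ~-ren {φ = φ} {ψ} f e .under g r =
    trans (ren-∘ g f φ) (trans (e .under (g ∘ f) (Resp-map r)) (sym (ren-∘ g f ψ)))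

  ~-⟨⟩ : ∀ {Γ} {φ ψ : Formula 1} y → Γ ⊢ φ ~ ψ → Γ ⊢ φ ⟨ y ⟩ ~ ψ ⟨ y ⟩
  ~-⟨⟩ {φ = φ} {ψ} y e .under f r =
    trans (ren-⟨⟩ f φ y) (trans (cong (_⟨ f y ⟩) (e .under f r)) (sym (ren-⟨⟩ f ψ y)))

  -- Collapsing all names to one solves any equations, so formulas equal modulo `Γ` have the same
  -- shape. This gives equal sizes and excludes clashes of connectives.
  constant : ∀ {Γ k} {φ ψ : Formula k} → Γ ⊢ φ ~ ψ → ren (const 0) φ ≡ ren (const 0) ψ
  constant e = e .under (const 0) (λ _ → refl)

  ~-size : ∀ {Γ k} {φ ψ : Formula k} → Γ ⊢ φ ~ ψ → size φ ≡ size ψ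
  ~-size {φ = φ} {ψ} e =
    trans (sym (size-ren _ φ)) (trans (cong size (constant e)) (size-ren _ ψ))

  ⊃-injective : ∀ {k} {φ φ′ ψ ψ′ : Formula k} → φ ⊃ ψ ≡ φ′ ⊃ ψ′ → φ ≡ φ′ × ψ ≡ ψ′
  ⊃-injective refl = refl , refl

  ∀-injective : ∀ {k} {φ φ′ : Formula (suc k)} → ∀ᶠ φ ≡ ∀ᶠ φ′ → φ ≡ φ′
  ∀-injective refl = refl

  ~-⊃₁ : ∀ {Γ k} {φ φ′ ψ ψ′ : Formula k} → Γ ⊢ φ ⊃ ψ ~ φ′ ⊃ ψ′ → Γ ⊢ φ ~ φ′
  ~-⊃₁ e .under f r = proj₁ (⊃-injective (e .under f r))

  ~-⊃₂ : ∀ {Γ k} {φ φ′ ψ ψ′ : Formula k} → Γ ⊢ φ ⊃ ψ ~ φ′ ⊃ ψ′ → Γ ⊢ ψ ~ ψ′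
  ~-⊃₂ e .under f r = proj₂ (⊃-injective (e .under f r))

  ~-∀ : ∀ {Γ k} {φ φ′ : Formula (suc k)} → Γ ⊢ ∀ᶠ φ ~ ∀ᶠ φ′ → Γ ⊢ φ ~ φ′
  ~-∀ {φ = φ} {φ′} e .under f r =
    ∀-injective (trans (sym (ren-∀ f φ)) (trans (e .under f r) (ren-∀ f φ′)))

  _∈[_]_ : Formula 0 → List (Formula 0) → List (Formula 0) → Set
  φ ∈[ Γ ] Δ = Any (Γ ⊢ φ ~_) Δ

  _⊆[_]_ : (Γ₁ Γ Δ : List (Formula 0)) → Set
  Γ₁ ⊆[ Γ ] Δ = All (_∈[ Γ ] Δ) Γ₁

  ∈⇒∈[] : ∀ {Γ Δ φ} → φ ∈ˡ Δ → φ ∈[ Γ ] Δ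
  ∈⇒∈[] = Any.map ~-reflexive

  ⊆⇒⊆[] : ∀ {Γ₁ Γ Δ} → Γ₁ ⊆ˡ Δ → Γ₁ ⊆[ Γ ] Δ
  ⊆⇒⊆[] sub = All.tabulate (∈⇒∈[] ∘ sub)

  ⊆[]-refl : ∀ {Γ Δ} → Δ ⊆[ Γ ] Δ
  ⊆[]-refl = ⊆⇒⊆[] id

  ⊆⇒≽ : ∀ {Γ Γ′} → Γ ⊆ˡ Γ′ → Γ′ ≽ Γ
  ⊆⇒≽ sub r m = r (sub m)

  equation-holds : ∀ {f Γ a b} ψ → Resp f Γ → ψ ∈ˡ Γ → free a ≈ free b ≡ ren f ψ → a ≡ b
  equation-holds (free c ≈ free d) r m refl = r m

  -- A formula that becomes an equation under `f` is itself an equation. An equation of `Γ₁` is thus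
  -- matched by one of `Γ`, which `f` already solves.
  ⊆[]⇒≽ : ∀ {Γ₁ Γ} → Γ₁ ⊆[ Γ ] Γ → Γ ≽ Γ₁
  ⊆[]⇒≽ s {f} r m with ψ , ψ∈ , e ← find (All.lookup s m) =
    equation-holds ψ r ψ∈ (e .under f r)

  ~∈ : ∀ {Γ Δ φ ψ} → Γ ⊢ φ ~ ψ → ψ ∈[ Γ ] Δ → φ ∈[ Γ ] Δ
  ~∈ e = Any.map (~-trans e)

  ∈[]-mono : ∀ {Γ Γ′ Δ φ} → Γ′ ≽ Γ → φ ∈[ Γ ] Δ → φ ∈[ Γ′ ] Δ
  ∈[]-mono Γ′≽Γ = Any.map (~-mono Γ′≽Γ)

  ∈[]-⊆[] : ∀ {Γ Δ Δ₁ φ} → φ ∈[ Γ ] Δ₁ → Δ₁ ⊆[ Γ ] Δ → φ ∈[ Γ ] Δ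
  ∈[]-⊆[] φ∈ s with _ , ψ∈ , e ← find φ∈ = ~∈ e (All.lookup s ψ∈)

  carry : ∀ {Γ Γ₁ Δ Δ₁ φ} → Γ ≽ Γ₁ → Δ₁ ⊆[ Γ ] Δ → φ ∈[ Γ₁ ] Δ₁ → φ ∈[ Γ ] Δ
  carry Γ≽Γ₁ s φ∈ = ∈[]-⊆[] (∈[]-mono Γ≽Γ₁ φ∈) s

  ∈[]-ren : ∀ {Γ Δ φ} f → φ ∈[ Γ ] Δ → ren f φ ∈[ map (ren f) Γ ] map (ren f) Δ
  ∈[]-ren f φ∈ = Any.map⁺ (Any.map (~-ren f) φ∈)

  ⊆[]-ren : ∀ {Γ Γ₁ Δ} f → Γ₁ ⊆[ Γ ] Δ → map (ren f) Γ₁ ⊆[ map (ren f) Γ ] map (ren f) Δ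
  ⊆[]-ren f s = All.map⁺ (All.map (∈[]-ren f) s)

  ⊆[]-++ : ∀ {Γ Γ′ Δ Δ₁} Σ′ → Γ′ ≽ Γ → Δ₁ ⊆[ Γ ] Δ → (Σ′ ++ Δ₁) ⊆[ Γ′ ] (Σ′ ++ Δ)
  ⊆[]-++ Σ′ Γ′≽Γ s = All.++⁺ (⊆⇒⊆[] ∈-++⁺ˡ)
    (All.map (Any.++⁺ʳ Σ′ ∘ ∈[]-mono Γ′≽Γ) s)

  ⊆[]-under : ∀ {Γ Γ′ Δ Δ₁ A} Σ′ → Γ′ ≽ Γ → Δ₁ ⊆[ Γ ] (A ∷ Δ) →
              (Σ′ ++ Δ₁) ⊆[ Γ′ ] (A ∷ Σ′ ++ Δ)
  ⊆[]-under Σ′ Γ′≽Γ s = All.++⁺ (⊆⇒⊆[] (there ∘ ∈-++⁺ˡ)) (All.map insert s)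
    where
    insert : ∀ {φ} → φ ∈[ _ ] (_ ∷ _) → φ ∈[ _ ] (_ ∷ Σ′ ++ _)
    insert (here e)   = here (~-mono Γ′≽Γ e)
    insert (there φ∈) = there (Any.++⁺ʳ Σ′ (∈[]-mono Γ′≽Γ φ∈))

  ++-≽ : ∀ Σ′ {Γ} → (Σ′ ++ Γ) ≽ Γ
  ++-≽ Σ′ = ⊆⇒≽ (∈-++⁺ʳ Σ′)

  map-ren-∘ : ∀ g f (Γ : List (Formula 0)) →
              map (ren g) (map (ren f) Γ) ≡ map (ren (g ∘ f)) Γ
  map-ren-∘ g f Γ = trans (sym (map-∘ Γ)) (map-cong (ren-∘ g f) Γ)

  map-ren-id : (Γ : List (Formula 0)) → map (ren id) Γ ≡ Γ
  map-ren-id Γ = trans (map-cong ren-id Γ) (map-id Γ)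

  ren-modalAt : ∀ f z τ a → ren f (modalAt z τ a) ≡ modalAt (f z) (ren f ∘ τ) a
  ren-modalAt f z τ (♥ · ps) =
    trans (ren-modal f (free z) ♥ _) (cong (modal _ ♥) (sym (Vec.map-∘ (ren f) τ ps)))

  instantiate : (Name → Name) → (SVar → Formula 1) → Name → SVar → Formula 0
  instantiate f τ y p = ren f (τ p) ⟨ y ⟩

  -- Identifying the schematic variables of several occurrences of one atom

  _≈ᵛ[_]_ : ∀ {n} → Vec (Formula 1) n → List (Formula 0) → Vec (Formula 1) n → Set
  φs ≈ᵛ[ Γ ] ψs = Pointwise (Γ ⊢_~_) φs ψs

  ~⇒≈ᵛ : ∀ {Γ n} (φs ψs : Vec (Formula 1) n) →
         (∀ f → Resp f Γ → Vec.map (ren f) φs ≡ Vec.map (ren f) ψs) → φs ≈ᵛ[ Γ ] ψs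
  ~⇒≈ᵛ []       []       e = []
  ~⇒≈ᵛ (φ ∷ φs) (ψ ∷ ψs) e =
    mk~ (λ f r → Vec.∷-injectiveˡ (e f r)) ∷ ~⇒≈ᵛ φs ψs (λ f r → Vec.∷-injectiveʳ (e f r))

  ≈ᵛ⇒~ : ∀ {Γ n} {φs ψs : Vec (Formula 1) n} → φs ≈ᵛ[ Γ ] ψs →
         ∀ f → Resp f Γ → Vec.map (ren f) φs ≡ Vec.map (ren f) ψs
  ≈ᵛ⇒~ []       f r = refl
  ≈ᵛ⇒~ (e ∷ es) f r = cong₂ _∷_ (e .under f r) (≈ᵛ⇒~ es f r)

  infix 4 _⊢_≈ⁿ_

  _⊢_≈ⁿ_ : List (Formula 0) → Name → Name → Set
  Γ ⊢ z ≈ⁿ w = ∀ f → Resp f Γ → f z ≡ f w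

  ~-modal : ∀ {Γ z w ♥ φs ψs} → Γ ⊢ z ≈ⁿ w → φs ≈ᵛ[ Γ ] ψs →
            Γ ⊢ modal (free z) ♥ φs ~ modal (free w) ♥ ψs
  ~-modal {φs = φs} {ψs} z≈w es .under f r =
    trans (ren-modal f _ _ φs)
      (trans (cong₂ (λ x → modal (free x) _) (z≈w f r) (≈ᵛ⇒~ es f r)) (sym (ren-modal f _ _ ψs)))

  ~-modalAt : ∀ {Γ z w τ τ′} a → Γ ⊢ z ≈ⁿ w → (∀ p → Γ ⊢ τ p ~ τ′ p) →
              Γ ⊢ modalAt z τ a ~ modalAt w τ′ a
  ~-modalAt (♥ · ps) z≈w e = ~-modal z≈w (pointwise ps)
    where
    pointwise : ∀ {n} (ps : Vec SVar n) → Vec.map _ ps ≈ᵛ[ _ ] Vec.map _ ps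
    pointwise []       = []
    pointwise (p ∷ ps) = e p ∷ pointwise ps

  modal-op : ∀ {k u v ♥ ♥′ φs ψs} → _≡_ {A = Formula k} (modal u ♥ φs) (modal v ♥′ ψs) → ♥ ≡ ♥′
  modal-op refl = refl

  modal-injective : ∀ {k} {u v : Var k} {♥ φs ψs} → modal u ♥ φs ≡ modal v ♥ ψs → u ≡ v × φs ≡ ψs
  modal-injective refl = refl , refl

  free-injective : ∀ {k x y} → free {k = k} x ≡ free y → x ≡ y
  free-injective refl = refl

  ~-modal⁻ : ∀ {Γ z w ♥ φs ψs} → Γ ⊢ modal (free z) ♥ φs ~ modal (free w) ♥ ψs →
             Γ ⊢ z ≈ⁿ w × φs ≈ᵛ[ Γ ] ψs
  ~-modal⁻ {Γ} {z} {w} {♥} {φs} {ψs} e =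
      (λ f r → free-injective (proj₁ (parts f r)))
    , ~⇒≈ᵛ φs ψs (λ f r → proj₂ (parts f r))
    where
    parts : ∀ f → Resp f Γ →
            free {k = 0} (f z) ≡ free (f w) × Vec.map (ren f) φs ≡ Vec.map (ren f) ψs
    parts f r =
      modal-injective (trans (sym (ren-modal f _ _ φs)) (trans (e .under f r) (ren-modal f _ _ ψs)))

  -- Equations affect names only, so every atom that matches the given formula has the operator `♥`.
  matches : ∀ {Γ z τ w ♥ φs} (as : List Atom) →
            All (λ a → Γ ⊢ modalAt z τ a ~ modal (free w) ♥ φs) as →
            ∃[ pss ] as ≡ map (♥ ·_) pss × All (λ ps → Vec.map τ ps ≈ᵛ[ Γ ] φs) pss
  matches [] [] = [] , refl , []
  matches (♥ · ps ∷ as) (e ∷ es) with refl ← modal-op (constant e)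
    with pss , refl , ms ← matches as es = ps ∷ pss , refl , proj₂ (~-modal⁻ e) ∷ ms

  override : ∀ {n} → Vec SVar n → Vec SVar n → (SVar → SVar) → SVar → SVar
  override []       []       ρ = ρ
  override (p ∷ ps) (q ∷ qs) ρ = override ps qs ρ [ p ↦ q ]

  map-↦ : ∀ {n p q} (ρ : SVar → SVar) (ps : Vec SVar n) → All (p ≢_) (toList ps) →
          Vec.map (ρ [ p ↦ q ]) ps ≡ Vec.map ρ ps
  map-↦ ρ []       []         = refl
  map-↦ ρ (x ∷ ps) (p≢x ∷ p∉) = cong₂ _∷_ (↦-there ρ (p≢x ∘ sym)) (map-↦ ρ ps p∉)

  map-override : ∀ {n} (ps qs : Vec SVar n) ρ → Unique (toList ps) →
                 Vec.map (override ps qs ρ) ps ≡ qs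
  map-override []       []       ρ u        = refl
  map-override (p ∷ ps) (q ∷ qs) ρ (p∉ ∷ u) =
    cong₂ _∷_ (↦-here (override ps qs ρ) p)
      (trans (map-↦ (override ps qs ρ) ps p∉) (map-override ps qs ρ u))

  map-override-disjoint : ∀ {m n} (ps qs : Vec SVar n) ρ (xs : Vec SVar m) →
                          All (λ p → All (p ≢_) (toList xs)) (toList ps) →
                          Vec.map (override ps qs ρ) xs ≡ Vec.map ρ xs
  map-override-disjoint []       []       ρ xs []       = refl
  map-override-disjoint (p ∷ ps) (q ∷ qs) ρ xs (d ∷ ds) =
    trans (map-↦ _ xs d) (map-override-disjoint ps qs ρ xs ds)

  override-tagged : ∀ {n} (ps qs : Vec SVar n) ρ x →
                    override ps qs ρ x ≡ ρ x ⊎ override ps qs ρ x ∈ˡ toList qs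
  override-tagged []       []       ρ x = inj₁ refl
  override-tagged (p ∷ ps) (q ∷ qs) ρ x with x ≟ p
  ... | yes _ = inj₂ (here refl)
  ... | no _ with override-tagged ps qs ρ x
  ...   | inj₁ e  = inj₁ e
  ...   | inj₂ q∈ = inj₂ (there q∈)

  override-~ : ∀ {Γ n τ τ′} (ps qs : Vec SVar n) ρ → Vec.map τ ps ≈ᵛ[ Γ ] Vec.map τ′ qs →
               (∀ x → Γ ⊢ τ x ~ τ′ (ρ x)) → ∀ x → Γ ⊢ τ x ~ τ′ (override ps qs ρ x)
  override-~ []       []       ρ []       h x = h x
  override-~ (p ∷ ps) (q ∷ qs) ρ (e ∷ es) h x with x ≟ p
  ... | yes refl = e
  ... | no _     = override-~ ps qs ρ es h x

  -- A unifier of the vectors `pss`: each is sent to `qs`, and every other variable to its code in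
  -- copy `o`.
  assign : ∀ {n} → Origin → Vec SVar n → List (Vec SVar n) → SVar → SVar
  assign o qs []         = encode o
  assign o qs (ps ∷ pss) = override ps qs (assign o qs pss)

  -- By linearity the vectors are disjoint and without repetition, so overriding at one of them does
  -- not disturb the others.
  map-assign : ∀ {n} o (qs : Vec SVar n) pss → Unique (concatMap toList pss) →
               All (λ ps → Vec.map (assign o qs pss) ps ≡ qs) pss
  map-assign o qs []         u = []
  map-assign o qs (ps ∷ pss) u with u₁ , u₂ , d ← unique-++⁻ (toList ps) u =
    map-override ps qs _ u₁ ∷ extend pss (All.map All.concat⁻ d) (map-assign o qs pss u₂)
    where
    extend : ∀ {ρ} xss → All (λ p → All (All (p ≢_)) (map toList xss)) (toList ps) →
             All (λ xs → Vec.map ρ xs ≡ qs) xss →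
             All (λ xs → Vec.map (override ps qs ρ) xs ≡ qs) xss
    extend []         d []       = []
    extend (xs ∷ xss) d (e ∷ es) =
      trans (map-override-disjoint ps qs _ xs (All.map All.head d)) e ∷
      extend xss (All.map All.tail d) es

  assign-tagged : ∀ {n} o (qs : Vec SVar n) pss → Tagged o (assign o qs pss) (toList qs)
  assign-tagged o qs []         p = inj₁ refl
  assign-tagged o qs (ps ∷ pss) p with override-tagged ps qs (assign o qs pss) p
  ... | inj₂ q∈ = inj₂ q∈
  ... | inj₁ e  =
    [ inj₁ ∘ trans e , inj₂ ∘ subst (_∈ˡ toList qs) (sym e) ]′ (assign-tagged o qs pss p)

  assign-~ : ∀ {Γ n τ τ′} o (qs : Vec SVar n) pss →
             All (λ ps → Vec.map τ ps ≈ᵛ[ Γ ] Vec.map τ′ qs) pss →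
             (∀ p → τ p ≡ τ′ (encode o p)) → ∀ p → Γ ⊢ τ p ~ τ′ (assign o qs pss p)
  assign-~ o qs []         []       h p = ~-reflexive (h p)
  assign-~ o qs (ps ∷ pss) (e ∷ es) h p = override-~ ps qs _ e (assign-~ o qs pss es h) p

  nth : ∀ {n} → Vec (Formula 1) n → ℕ → Formula 1
  -- An arbitrary value beyond the last argument.
  nth []       _       = ⊥ᶠ
  nth (φ ∷ φs) zero    = φ
  nth (φ ∷ φs) (suc i) = nth φs i

  nth-toℕ : ∀ {n} (φs : Vec (Formula 1) n) i → nth φs (toℕ i) ≡ Vec.lookup φs i
  nth-toℕ (φ ∷ φs) zero    = refl
  nth-toℕ (φ ∷ φs) (suc i) = nth-toℕ φs i

  arguments : ∀ n → Vec SVar n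
  arguments n = Vec.tabulate (encode argument ∘ toℕ)

  -- One assignment for all three copies: the arguments of the cut formula, and the separate
  -- assignments of the two rules.
  joint : ∀ {n} → Vec (Formula 1) n → (τ₁ τ₂ : SVar → Formula 1) → SVar → Formula 1
  joint φs τ₁ τ₂ x = pick (decode x)
    where
    pick : Origin × ℕ → Formula 1
    pick (argument , i) = nth φs i
    pick (left , p)     = τ₁ p
    pick (right , p)    = τ₂ p

  joint-argument : ∀ {n} (φs : Vec (Formula 1) n) τ₁ τ₂ i →
                   joint φs τ₁ τ₂ (encode argument i) ≡ nth φs i
  joint-argument φs τ₁ τ₂ i rewrite decode-encode argument i = refl

  joint-left : ∀ {n} (φs : Vec (Formula 1) n) τ₁ τ₂ p → τ₁ p ≡ joint φs τ₁ τ₂ (encode left p)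
  joint-left φs τ₁ τ₂ p rewrite decode-encode left p = refl

  joint-right : ∀ {n} (φs : Vec (Formula 1) n) τ₁ τ₂ p → τ₂ p ≡ joint φs τ₁ τ₂ (encode right p)
  joint-right φs τ₁ τ₂ p rewrite decode-encode right p = refl

  joint-arguments : ∀ {n} (φs : Vec (Formula 1) n) τ₁ τ₂ →
                    Vec.map (joint φs τ₁ τ₂) (arguments n) ≡ φs
  joint-arguments φs τ₁ τ₂ =
    trans (sym (Vec.tabulate-∘ (joint φs τ₁ τ₂) (encode argument ∘ toℕ)))
      (trans (Vec.tabulate-cong (λ i → trans (joint-argument φs τ₁ τ₂ (toℕ i)) (nth-toℕ φs i)))
        (Vec.tabulate∘lookup φs))

  occurrences-unique : ∀ {xs} others hs → xs ↭ others ++ hs →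
                       Unique (concatMap svars xs) → Unique (concatMap svars hs)
  occurrences-unique others hs perm u =
    proj₁ (proj₂ (unique-++⁻ (concatMap svars others)
      (subst Unique (concatMap-++ svars others hs) (unique-↭ (concatMap-↭ svars perm) u))))

  concatMap-svars : ∀ ♥ pss → concatMap svars (map (♥ ·_) pss) ≡ concatMap toList pss
  concatMap-svars ♥ []         = refl
  concatMap-svars ♥ (ps ∷ pss) = cong (toList ps ++_) (concatMap-svars ♥ pss)

  -- What a rule needs in order to be instantiated so that the matching atoms hs become
  -- copies of ♥ · arguments, while its other variables are kept apart.
  record Unified (Γ : List (Formula 0)) (o : Origin) (τ τ′ : SVar → Formula 1)
                 (♥ : Λ) (hs : List Atom) : Set where
    field
      ρ      : SVar → SVar
      tagged : Tagged o ρ (toList (arguments (ar ♥)))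
      agrees : ∀ p → Γ ⊢ τ p ~ τ′ (ρ p)
      copies : map (renameAtom ρ) hs ≡ replicate (length hs) (♥ · arguments (ar ♥))

  unify : ∀ {Γ τ τ′ z w ♥ φs} o hs → Unique (concatMap svars hs) →
          All (λ a → Γ ⊢ modalAt z τ a ~ modal (free w) ♥ φs) hs →
          Vec.map τ′ (arguments (ar ♥)) ≡ φs → (∀ p → τ p ≡ τ′ (encode o p)) →
          Unified Γ o τ τ′ ♥ hs
  unify {Γ} {τ} {τ′} {♥ = ♥} o hs u es refl h with pss , refl , ms ← matches hs es = record
    { ρ      = assign o qs pss
    ; tagged = assign-tagged o qs pss
    ; agrees = assign-~ o qs pss ms h
    ; copies = copy pss (map-assign o qs pss (subst Unique (concatMap-svars ♥ pss) u))
    }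
    where
    qs : Vec SVar (ar ♥)
    qs = arguments (ar ♥)

    copy : ∀ {ρ} pss → All (λ ps → Vec.map ρ ps ≡ qs) pss →
           map (renameAtom ρ) (map (♥ ·_) pss) ≡ replicate (length (map (♥ ·_) pss)) (♥ · qs)
    copy []         []       = refl
    copy (ps ∷ pss) (e ∷ es) = cong₂ _∷_ (cong (♥ ·_) e) (copy pss es)

-- The auxiliary calculus, its structural rules and the renaming of its derivations.

module Calculus {ℓ : Level} (𝒮 : Signature) (𝓡 : Pred (CPL.OneStepRule 𝒮) ℓ) where

  open Signature 𝒮
  open CPL 𝒮
  open Renaming 𝒮
  open _⊢_~_

  -- Principal formulas persist, so structural rules are admissible.  The premises of ∀R and
  -- modal range over all renamings, which replaces the eigenvariable condition.

  infix 3 _⟹_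

  data _⟹_ (Γ Δ : List (Formula 0)) : Set ℓ where
    ax    : ∀ {φ} → φ ∈[ Γ ] Γ → φ ∈[ Γ ] Δ → Γ ⟹ Δ
    ⊥L    : ⊥ᶠ ∈[ Γ ] Γ → Γ ⟹ Δ
    ≈R    : ∀ {a} → (free a ≈ free a) ∈[ Γ ] Δ → Γ ⟹ Δ
    ⊃R    : ∀ {φ ψ} → (φ ⊃ ψ) ∈[ Γ ] Δ → φ ∷ Γ ⟹ ψ ∷ Δ → Γ ⟹ Δ
    ⊃L    : ∀ {φ ψ} → (φ ⊃ ψ) ∈[ Γ ] Γ → Γ ⟹ φ ∷ Δ → ψ ∷ Γ ⟹ Δ → Γ ⟹ Δ
    ∀R    : ∀ {φ} → ∀ᶠ φ ∈[ Γ ] Δ →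
            (∀ f y → map (ren f) Γ ⟹ ren f φ ⟨ y ⟩ ∷ map (ren f) Δ) → Γ ⟹ Δ
    ∀L    : ∀ {φ} z → ∀ᶠ φ ∈[ Γ ] Γ → φ ⟨ z ⟩ ∷ Γ ⟹ Δ → Γ ⟹ Δ
    modal : ∀ {R} → R ∈ 𝓡 → ∀ τ z →
            All (λ a → modalAt z τ a ∈[ Γ ] Γ) (ante (conclusion (schema R))) →
            All (λ a → modalAt z τ a ∈[ Γ ] Δ) (succ (conclusion (schema R))) →
            (∀ P → premises (schema R) ⊩ P → ∀ f y →
              map (instantiate f τ y) (ante P) ++ map (ren f) Γ ⟹
              map (instantiate f τ y) (succ P) ++ map (ren f) Δ) →
            Γ ⟹ Δ

  Premises : List (Formula 0) → List (Formula 0) → List (Sequent SVar) → (SVar → Formula 1) → Set ℓ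
  Premises Γ Δ Ps τ =
    ∀ P → Ps ⊩ P → ∀ f y →
      map (instantiate f τ y) (ante P) ++ map (ren f) Γ ⟹
      map (instantiate f τ y) (succ P) ++ map (ren f) Δ

  -- Weakening, contraction and replacement of equals at once. Principal formulas need only be
  -- present modulo the equations, and this presence carries over to the larger context.
  repl : ∀ {Γ₁ Δ₁ Γ Δ} → Γ₁ ⟹ Δ₁ → Γ₁ ⊆[ Γ ] Γ → Δ₁ ⊆[ Γ ] Δ → Γ ⟹ Δ
  repl {Γ = Γ} (ax i j) s t = ax (carry (⊆[]⇒≽ s) s i) (carry (⊆[]⇒≽ s) t j)
  repl (⊥L i) s t = ⊥L (carry (⊆[]⇒≽ s) s i)
  repl (≈R i) s t = ≈R (carry (⊆[]⇒≽ s) t i)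
  repl (⊃R {φ} {ψ} i p) s t =
    ⊃R (carry (⊆[]⇒≽ s) t i)
      (repl p (⊆[]-++ (φ ∷ []) (++-≽ (φ ∷ [])) s) (⊆[]-++ (ψ ∷ []) (++-≽ (φ ∷ [])) t))
  repl (⊃L {φ} {ψ} i p q) s t =
    ⊃L (carry (⊆[]⇒≽ s) s i)
      (repl p s (⊆[]-++ (φ ∷ []) id t))
      (repl q (⊆[]-++ (ψ ∷ []) (++-≽ (ψ ∷ [])) s) (⊆[]-++ [] (++-≽ (ψ ∷ [])) t))
  repl (∀R i p) s t =
    ∀R (carry (⊆[]⇒≽ s) t i)
      (λ f y → repl (p f y) (⊆[]-ren f s) (⊆[]-++ (_ ∷ []) id (⊆[]-ren f t)))
  repl (∀L {φ} z i p) s t =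
    ∀L z (carry (⊆[]⇒≽ s) s i)
      (repl p (⊆[]-++ (_ ∷ []) (++-≽ (φ ⟨ z ⟩ ∷ [])) s) (⊆[]-++ [] (++-≽ (φ ⟨ z ⟩ ∷ [])) t))
  repl (modal R∈ τ z as ss p) s t =
    modal R∈ τ z (All.map (carry (⊆[]⇒≽ s) s) as) (All.map (carry (⊆[]⇒≽ s) t) ss)
      (λ P e f y → let Σ′ = map (instantiate f τ y) (ante P) in
        repl (p P e f y) (⊆[]-++ Σ′ (++-≽ Σ′) (⊆[]-ren f s))
          (⊆[]-++ (map (instantiate f τ y) (succ P)) (++-≽ Σ′) (⊆[]-ren f t)))

  weaken : ∀ {Γ₁ Δ₁ Γ Δ} → Γ₁ ⟹ Δ₁ → Γ₁ ⊆ˡ Γ → Δ₁ ⊆ˡ Δ → Γ ⟹ Δ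
  weaken p s t = repl p (⊆⇒⊆[] s) (⊆⇒⊆[] t)

  cast : ∀ {Γ Γ′ Δ Δ′} → Γ ≡ Γ′ → Δ ≡ Δ′ → Γ ⟹ Δ → Γ′ ⟹ Δ′
  cast refl refl p = p

  map-instantiate-∘ : ∀ g f τ y (ps : List SVar) (Γ : List (Formula 0)) →
                      map (instantiate (g ∘ f) τ y) ps ++ map (ren (g ∘ f)) Γ ≡
                      map (instantiate g (ren f ∘ τ) y) ps ++ map (ren g) (map (ren f) Γ)
  map-instantiate-∘ g f τ y ps Γ =
    cong₂ _++_ (map-cong (λ p → cong (_⟨ y ⟩) (sym (ren-∘ g f (τ p)))) ps) (sym (map-ren-∘ g f Γ))

  Premises-ren : ∀ {Γ Δ Ps τ} f → Premises Γ Δ Ps τ →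
                 Premises (map (ren f) Γ) (map (ren f) Δ) Ps (ren f ∘ τ)
  Premises-ren {Γ} {Δ} {τ = τ} f p P e g y =
    cast (map-instantiate-∘ g f τ y (ante P) Γ) (map-instantiate-∘ g f τ y (succ P) Δ)
      (p P e (g ∘ f) y)

  Premises-repl : ∀ {Γ Δ Γ′ Δ′ Ps τ} → Γ ⊆[ Γ′ ] Γ′ → Δ ⊆[ Γ′ ] Δ′ →
                  Premises Γ Δ Ps τ → Premises Γ′ Δ′ Ps τ
  Premises-repl {τ = τ} s t p P e f y =
    let Σ′ = map (instantiate f τ y) (ante P) in
    repl (p P e f y) (⊆[]-++ Σ′ (++-≽ Σ′) (⊆[]-ren f s))
      (⊆[]-++ (map (instantiate f τ y) (succ P)) (++-≽ Σ′) (⊆[]-ren f t))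

  modalAt-ren : ∀ {Γ Δ τ z} f as → All (λ a → modalAt z τ a ∈[ Γ ] Δ) as →
                All (λ a → modalAt (f z) (ren f ∘ τ) a ∈[ map (ren f) Γ ] map (ren f) Δ) as
  modalAt-ren {τ = τ} {z} f as = All.map λ {a} i →
    ~∈ (~-reflexive (sym (ren-modalAt f z τ a))) (∈[]-ren f i)

  -- Premises that range over all renamings are taken at composites with `f`, so no eigenvariable
  -- has to be avoided.
  rename-proof : ∀ {Γ Δ} f → Γ ⟹ Δ → map (ren f) Γ ⟹ map (ren f) Δ
  rename-proof f (ax i j) = ax (∈[]-ren f i) (∈[]-ren f j)
  rename-proof f (⊥L i) = ⊥L (∈[]-ren f i)
  rename-proof f (≈R i) = ≈R (∈[]-ren f i)
  rename-proof f (⊃R i p) = ⊃R (∈[]-ren f i) (rename-proof f p)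
  rename-proof f (⊃L i p q) = ⊃L (∈[]-ren f i) (rename-proof f p) (rename-proof f q)
  rename-proof {Γ} {Δ} f (∀R {φ} i p) =
    ∀R (~∈ (~-reflexive (sym (ren-∀ f φ))) (∈[]-ren f i))
      (λ g y → cast (sym (map-ren-∘ g f Γ))
        (cong₂ (λ φ Δ → φ ⟨ y ⟩ ∷ Δ) (sym (ren-∘ g f φ)) (sym (map-ren-∘ g f Δ))) (p (g ∘ f) y))
  rename-proof f (∀L {φ} z i p) =
    ∀L (f z) (~∈ (~-reflexive (sym (ren-∀ f φ))) (∈[]-ren f i))
      (cast (cong (_∷ _) (ren-⟨⟩ f φ z)) refl (rename-proof f p))
  rename-proof f (modal {R} R∈ τ z as ss p) =
    modal R∈ (ren f ∘ τ) (f z) (modalAt-ren f _ as) (modalAt-ren f _ ss)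
      (Premises-ren {Ps = premises (schema R)} f p)

  -- A last inference with principal formula A on the right, after A has been cut from its
  -- premises.
  data Introduced (Γ Δ : List (Formula 0)) (A : Formula 0) : Set ℓ where
    ≈I     : ∀ {a} → Γ ⊢ free a ≈ free a ~ A → Introduced Γ Δ A
    ⊃I     : ∀ {φ ψ} → Γ ⊢ φ ⊃ ψ ~ A → φ ∷ Γ ⟹ ψ ∷ Δ → Introduced Γ Δ A
    ∀I     : ∀ {φ} → Γ ⊢ ∀ᶠ φ ~ A →
             (∀ f y → map (ren f) Γ ⟹ ren f φ ⟨ y ⟩ ∷ map (ren f) Δ) → Introduced Γ Δ A
    modalI : ∀ {R others h hs} → R ∈ 𝓡 → ∀ τ z →
             succ (conclusion (schema R)) ↭ others ++ h ∷ hs →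
             All (λ a → modalAt z τ a ∈[ Γ ] Γ) (ante (conclusion (schema R))) →
             All (λ a → modalAt z τ a ∈[ Γ ] Δ) others →
             All (λ a → Γ ⊢ modalAt z τ a ~ A) (h ∷ hs) →
             Premises Γ Δ (premises (schema R)) τ →
             Introduced Γ Δ A

  Introduced-repl : ∀ {Γ Δ Γ′ Δ′ A} → Γ ⊆[ Γ′ ] Γ′ → Δ ⊆[ Γ′ ] Δ′ →
                    Introduced Γ Δ A → Introduced Γ′ Δ′ A
  Introduced-repl s t (≈I e) = ≈I (~-mono (⊆[]⇒≽ s) e)
  Introduced-repl s t (⊃I {φ} {ψ} e p) =
    ⊃I (~-mono (⊆[]⇒≽ s) e)
      (repl p (⊆[]-++ (φ ∷ []) (++-≽ (φ ∷ [])) s) (⊆[]-++ (ψ ∷ []) (++-≽ (φ ∷ [])) t))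
  Introduced-repl s t (∀I e p) =
    ∀I (~-mono (⊆[]⇒≽ s) e)
      (λ f y → repl (p f y) (⊆[]-ren f s) (⊆[]-++ (_ ∷ []) id (⊆[]-ren f t)))
  Introduced-repl s t (modalI {R} R∈ τ z perm as os hs p) =
    modalI R∈ τ z perm (All.map (carry (⊆[]⇒≽ s) s) as) (All.map (carry (⊆[]⇒≽ s) t) os)
      (All.map (~-mono (⊆[]⇒≽ s)) hs) (Premises-repl {Ps = premises (schema R)} s t p)

  Introduced-ren : ∀ {Γ Δ A} f → Introduced Γ Δ A →
                   Introduced (map (ren f) Γ) (map (ren f) Δ) (ren f A)
  Introduced-ren f (≈I e) = ≈I (~-ren f e)
  Introduced-ren f (⊃I e p) = ⊃I (~-ren f e) (rename-proof f p)
  Introduced-ren {Γ} {Δ} f (∀I {φ} e p) =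
    ∀I (~-trans (~-reflexive (sym (ren-∀ f φ))) (~-ren f e))
      (λ g y → cast (sym (map-ren-∘ g f Γ))
        (cong₂ (λ φ Δ → φ ⟨ y ⟩ ∷ Δ) (sym (ren-∘ g f φ)) (sym (map-ren-∘ g f Δ))) (p (g ∘ f) y))
  Introduced-ren f (modalI {R} R∈ τ z perm as os hs p) =
    modalI R∈ (ren f ∘ τ) (f z) perm (modalAt-ren f _ as) (modalAt-ren f _ os)
      (All.map (λ {a} e → ~-trans (~-reflexive (sym (ren-modalAt f z τ a))) (~-ren f e)) hs)
      (Premises-ren {Ps = premises (schema R)} f p)

  weaken-under : ∀ {Γ Δ A} Σ′ Θ → Introduced Γ Δ A → Introduced (Σ′ ++ Γ) (Θ ++ Δ) A
  weaken-under Σ′ Θ = Introduced-repl (⊆⇒⊆[] (∈-++⁺ʳ Σ′)) (⊆⇒⊆[] (∈-++⁺ʳ Θ))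

  -- Only reflexivity introduces an equation on the right; the other forms have a different head
  -- symbol.
  introduced-equation : ∀ {f Γ Δ A a b} → Introduced Γ Δ A → Resp f Γ →
                        free a ≈ free b ≡ ren f A → a ≡ b
  introduced-equation (≈I e) r eq with refl ← trans eq (sym (e .under _ r)) = refl
  introduced-equation (⊃I e _) r eq = case trans eq (sym (e .under _ r)) of λ ()
  introduced-equation (∀I e _) r eq = case trans eq (sym (e .under _ r)) of λ ()
  introduced-equation (modalI _ _ _ _ _ _ (e ∷ _) _) r eq =
    case trans eq (sym (e .under _ r)) of λ ()

  -- Removing the cut formula from the antecedent loses no equational information, since it can only
  -- be a trivial equation.
  introduced-≽ : ∀ {Γ Γ₂ Δ A} → Introduced Γ Δ A → Γ₂ ⊆[ Γ ] (A ∷ Γ) → Γ ≽ Γ₂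
  introduced-≽ I s {f} r m with All.lookup s m
  ... | here e = introduced-equation I r (e .under f r)
  ... | there i with ψ , ψ∈ , e ← find i = equation-holds ψ r ψ∈ (e .under f r)

  reintroduce : ∀ {Γ Δ A} → Introduced Γ Δ A → A ∈[ Γ ] Δ → Γ ⟹ Δ
  reintroduce (≈I e) i = ≈R (~∈ e i)
  reintroduce {Γ} {Δ} (⊃I e p) i = ⊃R (~∈ e i) p
  reintroduce (∀I e p) i = ∀R (~∈ e i) p
  reintroduce (modalI R∈ τ z perm as os hs p) i =
    modal R∈ τ z as (All-resp-↭ (↭-sym perm) (All.++⁺ os (All.map (λ e → ~∈ e i) hs))) p

  replaceL : ∀ {Γ Δ φ ψ} → Γ ⊢ φ ~ ψ → φ ∷ Γ ⟹ Δ → ψ ∷ Γ ⟹ Δ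
  replaceL e p = repl p (here (~-mono (⊆⇒≽ there) e) ∷ ⊆⇒⊆[] there) ⊆[]-refl

  replaceR : ∀ {Γ Δ φ ψ} → Γ ⊢ φ ~ ψ → Γ ⟹ φ ∷ Δ → Γ ⟹ ψ ∷ Δ
  replaceR e p = repl p ⊆[]-refl (here e ∷ ⊆⇒⊆[] there)

  -- Separating the principal atoms that match the cut formula from the others.

  record Split (F : Atom → Formula 0) (Γ Δ : List (Formula 0)) (A : Formula 0)
               (as : List Atom) : Set where
    constructor split
    field
      {others matching} : List Atom
      perm : as ↭ others ++ matching
      os   : All (λ a → F a ∈[ Γ ] Δ) others
      hs   : All (λ a → Γ ⊢ F a ~ A) matching

  splitOff : ∀ {F Γ Δ A as} → All (λ a → F a ∈[ Γ ] (A ∷ Δ)) as → Split F Γ Δ A as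
  splitOff [] = split ↭-refl [] []
  splitOff (here e ∷ is) with split {others} {matching} perm os hs ← splitOff is =
    split (↭-trans (↭.prep _ perm) (↭-sym (shift _ others matching))) os (e ∷ hs)
  splitOff (there i ∷ is) with split perm os hs ← splitOff is =
    split (↭.prep _ perm) (i ∷ os) hs

  unsplit : ∀ {F : Atom → Formula 0} {Γ Δ as others} →
            as ↭ others ++ [] → All (λ a → F a ∈[ Γ ] Δ) others →
            All (λ a → F a ∈[ Γ ] Δ) as
  unsplit perm os = All-resp-↭ (↭-sym perm) (All.++⁺ os [])

  -- Cut elimination, given the modal principal case.

  Cuttable : Formula 0 → Set ℓ
  Cuttable B = ∀ {Γ Δ} → Γ ⟹ B ∷ Δ → B ∷ Γ ⟹ Δ → Γ ⟹ Δ

  CutBelow : ℕ → Set ℓ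
  CutBelow n = ∀ B → size B < n → Cuttable B

  -- The case of two modal inferences with the same principal cut formula, isolated because it alone
  -- calls for absorption. Cuts on `A` have already been removed from the premises.
  ModalReduction : Set ℓ
  ModalReduction = ∀ {A Γ Δ R₁ R₂ τ₁ τ₂ z₁ z₂ others₁ others₂ h₁ h₂ hs₁ hs₂} →
    CutBelow (size A) → R₁ ∈ 𝓡 → R₂ ∈ 𝓡 →
    succ (conclusion (schema R₁)) ↭ others₁ ++ h₁ ∷ hs₁ →
    All (λ a → modalAt z₁ τ₁ a ∈[ Γ ] Γ) (ante (conclusion (schema R₁))) →
    All (λ a → modalAt z₁ τ₁ a ∈[ Γ ] Δ) others₁ →
    All (λ a → Γ ⊢ modalAt z₁ τ₁ a ~ A) (h₁ ∷ hs₁) →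
    Premises Γ Δ (premises (schema R₁)) τ₁ →
    ante (conclusion (schema R₂)) ↭ others₂ ++ h₂ ∷ hs₂ →
    All (λ a → modalAt z₂ τ₂ a ∈[ Γ ] Γ) others₂ →
    All (λ a → modalAt z₂ τ₂ a ∈[ Γ ] Δ) (succ (conclusion (schema R₂))) →
    All (λ a → Γ ⊢ modalAt z₂ τ₂ a ~ A) (h₂ ∷ hs₂) →
    Premises Γ Δ (premises (schema R₂)) τ₂ →
    Γ ⟹ Δ

  module CutStep (reduce : ModalReduction) where

    -- Induction on the right derivation, once `A` is principal on the left. The inclusions modulo
    -- `Γ` let the context vary while the derivation itself stays untouched, so the recursion is
    -- structural.
    cutRight : ∀ {A Γ Δ Γ₂ Δ₂} → CutBelow (size A) → Introduced Γ Δ A → Γ₂ ⟹ Δ₂ →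
               Γ₂ ⊆[ Γ ] (A ∷ Γ) → Δ₂ ⊆[ Γ ] Δ → Γ ⟹ Δ

    cutRight-⊃ : ∀ {A Γ Δ φ ψ} → CutBelow (size A) → Introduced Γ Δ A →
                 (φ ⊃ ψ) ∈[ Γ ] (A ∷ Γ) → Γ ⟹ φ ∷ Δ → ψ ∷ Γ ⟹ Δ → Γ ⟹ Δ
    cutRight-⊃ ih I (there i) p q = ⊃L i p q
    cutRight-⊃ ih (≈I e′) (here e) p q = case constant (~-trans e′ (~-sym e)) of λ ()
    cutRight-⊃ ih (∀I e′ _) (here e) p q = case constant (~-trans e′ (~-sym e)) of λ ()
    cutRight-⊃ ih (modalI _ _ _ _ _ _ (e′ ∷ _) _) (here e) p q =
      case constant (~-trans e′ (~-sym e)) of λ ()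
    cutRight-⊃ {A} ih (⊃I {φ′} {ψ′} e′ p′) (here e) p q =
      -- The inner cut on `φ′` provides `ψ′` on the right, and the outer cut then removes it.
      ih ψ′ (subst (size ψ′ <_) (~-size e′) (s≤s (ℕ.m≤n+m _ (size φ′))))
        (ih φ′ (subst (size φ′ <_) (~-size e′) (s≤s (ℕ.m≤m+n _ (size ψ′))))
          (weaken (replaceR (~-⊃₁ e″) p) id (λ { (here x) → here x ; (there i) → there (there i) }))
          p′)
        (replaceL (~-⊃₂ e″) q)
      where
      e″ : _ ⊢ _ ~ φ′ ⊃ ψ′
      e″ = ~-trans e (~-sym e′)

    cutRight-∀ : ∀ {A Γ Δ φ} z → CutBelow (size A) → Introduced Γ Δ A →
                 ∀ᶠ φ ∈[ Γ ] (A ∷ Γ) → φ ⟨ z ⟩ ∷ Γ ⟹ Δ → Γ ⟹ Δ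
    cutRight-∀ z ih I (there i) p = ∀L z i p
    cutRight-∀ z ih (≈I e′) (here e) p = case constant (~-trans e′ (~-sym e)) of λ ()
    cutRight-∀ z ih (⊃I e′ _) (here e) p = case constant (~-trans e′ (~-sym e)) of λ ()
    cutRight-∀ z ih (modalI _ _ _ _ _ _ (e′ ∷ _) _) (here e) p =
      case constant (~-trans e′ (~-sym e)) of λ ()
    cutRight-∀ {Γ = Γ} {Δ} z ih (∀I {φ′} e′ p′) (here e) p =
      ih (φ′ ⟨ z ⟩) (subst₂ _<_ (sym (size-⟨⟩ φ′ z)) (~-size e′) ℕ.≤-refl)
        -- The general premise is used at the identity renaming and at the witness `z` of the left
        -- rule.
        (cast (map-ren-id Γ) (cong₂ (λ φ Δ → φ ⟨ z ⟩ ∷ Δ) (ren-id φ′) (map-ren-id Δ)) (p′ id z))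
        (replaceL (~-⟨⟩ z (~-∀ (~-trans e (~-sym e′)))) p)

    cutRight-modal : ∀ {A Γ Δ R} → CutBelow (size A) → Introduced Γ Δ A → R ∈ 𝓡 → ∀ τ z →
                     Split (modalAt z τ) Γ Γ A (ante (conclusion (schema R))) →
                     All (λ a → modalAt z τ a ∈[ Γ ] Δ) (succ (conclusion (schema R))) →
                     Premises Γ Δ (premises (schema R)) τ → Γ ⟹ Δ
    cutRight-modal ih I R∈ τ z (split perm os []) ss p =
      modal R∈ τ z (unsplit {modalAt z τ} perm os) ss p
    cutRight-modal ih (≈I e′) R∈ τ z (split {matching = (_ · _) ∷ _} perm os (e ∷ _)) ss p =
      case constant (~-trans e′ (~-sym e)) of λ ()
    cutRight-modal ih (⊃I e′ _) R∈ τ z (split {matching = (_ · _) ∷ _} perm os (e ∷ _)) ss p =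
      case constant (~-trans e′ (~-sym e)) of λ ()
    cutRight-modal ih (∀I e′ _) R∈ τ z (split {matching = (_ · _) ∷ _} perm os (e ∷ _)) ss p =
      case constant (~-trans e′ (~-sym e)) of λ ()
    cutRight-modal ih (modalI R′∈ τ′ z′ perm′ as′ os′ hs′ p′)
      R∈ τ z (split perm os hs@(_ ∷ _)) ss p =
      reduce ih R′∈ R∈ perm′ as′ os′ hs′ p′ perm os ss hs p

    below-ren : ∀ {A} f → CutBelow (size A) → CutBelow (size (ren f A))
    below-ren {A} f ih B lt = ih B (subst (size B <_) (size-ren f A) lt)

    cutRight ih I (ax i j) s t with ∈[]-⊆[] (∈[]-mono (introduced-≽ I s) i) s
    -- The axiom is on the cut formula, so `A` occurs in `Δ` modulo `Γ` and its introduction can be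
    -- performed there.
    ... | here e   = reintroduce I (~∈ (~-sym e) (carry (introduced-≽ I s) t j))
    ... | there i′ = ax i′ (carry (introduced-≽ I s) t j)
    cutRight ih I (⊥L i) s t with ∈[]-⊆[] (∈[]-mono (introduced-≽ I s) i) s
    ... | there i′ = ⊥L i′
    ... | here e with I
    ...   | ≈I e′ = case constant (~-trans e′ (~-sym e)) of λ ()
    ...   | ⊃I e′ _ = case constant (~-trans e′ (~-sym e)) of λ ()
    ...   | ∀I e′ _ = case constant (~-trans e′ (~-sym e)) of λ ()
    ...   | modalI _ _ _ _ _ _ (e′ ∷ _) _ = case constant (~-trans e′ (~-sym e)) of λ ()
    cutRight ih I (≈R i) s t = ≈R (carry (introduced-≽ I s) t i)
    cutRight ih I (⊃R {φ} {ψ} i p) s t =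
      ⊃R (carry (introduced-≽ I s) t i)
        (cutRight ih (weaken-under (φ ∷ []) (ψ ∷ []) I) p
          (⊆[]-under (φ ∷ []) (++-≽ (φ ∷ [])) s) (⊆[]-++ (ψ ∷ []) (++-≽ (φ ∷ [])) t))
    cutRight ih I (⊃L {φ} {ψ} i p q) s t =
      cutRight-⊃ ih I (∈[]-⊆[] (∈[]-mono (introduced-≽ I s) i) s)
        (cutRight ih (weaken-under [] (φ ∷ []) I) p s (⊆[]-++ (φ ∷ []) id t))
        (cutRight ih (weaken-under (ψ ∷ []) [] I) q
          (⊆[]-under (ψ ∷ []) (++-≽ (ψ ∷ [])) s) (⊆[]-++ [] (++-≽ (ψ ∷ [])) t))
    cutRight {A} ih I (∀R i p) s t =
      ∀R (carry (introduced-≽ I s) t i)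
        (λ f y → cutRight (below-ren {A} f ih)
          (weaken-under [] (_ ∷ []) (Introduced-ren f I)) (p f y)
          (⊆[]-ren f s) (⊆[]-++ (_ ∷ []) id (⊆[]-ren f t)))
    cutRight ih I (∀L {φ} z i p) s t =
      cutRight-∀ z ih I (∈[]-⊆[] (∈[]-mono (introduced-≽ I s) i) s)
        (cutRight ih (weaken-under (φ ⟨ z ⟩ ∷ []) [] I) p
          (⊆[]-under (φ ⟨ z ⟩ ∷ []) (++-≽ (φ ⟨ z ⟩ ∷ [])) s)
          (⊆[]-++ [] (++-≽ (φ ⟨ z ⟩ ∷ [])) t))
    cutRight {A} ih I (modal R∈ τ z as ss p) s t =
      cutRight-modal ih I R∈ τ z
        (splitOff (All.map (λ i → ∈[]-⊆[] (∈[]-mono (introduced-≽ I s) i) s) as))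
        (All.map (carry (introduced-≽ I s) t) ss)
        (λ P e f y → let Σ′ = map (instantiate f τ y) (ante P)
                         Θ = map (instantiate f τ y) (succ P) in
          cutRight (below-ren {A} f ih) (weaken-under Σ′ Θ (Introduced-ren f I)) (p P e f y)
            (⊆[]-under Σ′ (++-≽ Σ′) (⊆[]-ren f s)) (⊆[]-++ Θ (++-≽ Σ′) (⊆[]-ren f t)))

    cutLeft-modal : ∀ {A Γ Δ R} → CutBelow (size A) → R ∈ 𝓡 → ∀ τ z →
                    All (λ a → modalAt z τ a ∈[ Γ ] Γ) (ante (conclusion (schema R))) →
                    Split (modalAt z τ) Γ Δ A (succ (conclusion (schema R))) →
                    Premises Γ Δ (premises (schema R)) τ → A ∷ Γ ⟹ Δ → Γ ⟹ Δ
    cutLeft-modal ih R∈ τ z as (split perm os []) p d =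
      modal R∈ τ z as (unsplit {modalAt z τ} perm os) p
    cutLeft-modal ih R∈ τ z as (split perm os hs@(_ ∷ _)) p d =
      cutRight ih (modalI R∈ τ z perm as os hs p) d ⊆[]-refl ⊆[]-refl

    weaken-after : ∀ {A Γ Δ} Σ′ Θ → A ∷ Γ ⟹ Δ → A ∷ Σ′ ++ Γ ⟹ Θ ++ Δ
    weaken-after Σ′ Θ d =
      weaken d (λ { (here x) → here x ; (there i) → there (∈-++⁺ʳ Σ′ i) }) (∈-++⁺ʳ Θ)

    -- Induction on the left derivation: `A` is first cut from the premises, and when it is
    -- principal as well, the resulting introduction is handed to `cutRight`.
    cutLeft : ∀ {A Γ Δ Γ₁ Δ₁} → CutBelow (size A) → Γ₁ ⟹ Δ₁ →
              Γ₁ ⊆[ Γ ] Γ → Δ₁ ⊆[ Γ ] (A ∷ Δ) → A ∷ Γ ⟹ Δ → Γ ⟹ Δ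
    cutLeft ih (ax i j) s t d with carry (⊆[]⇒≽ s) t j
    ... | here e   = repl d (~∈ (~-sym e) (carry (⊆[]⇒≽ s) s i) ∷ ⊆[]-refl) ⊆[]-refl
    ... | there j′ = ax (carry (⊆[]⇒≽ s) s i) j′
    cutLeft ih (⊥L i) s t d = ⊥L (carry (⊆[]⇒≽ s) s i)
    cutLeft ih (≈R i) s t d with carry (⊆[]⇒≽ s) t i
    ... | here e   = cutRight ih (≈I e) d ⊆[]-refl ⊆[]-refl
    ... | there i′ = ≈R i′
    cutLeft ih (⊃R {φ} {ψ} i p) s t d
      with carry (⊆[]⇒≽ s) t i
         | cutLeft ih p (⊆[]-++ (φ ∷ []) (++-≽ (φ ∷ [])) s)
             (⊆[]-under (ψ ∷ []) (++-≽ (φ ∷ [])) t) (weaken-after (φ ∷ []) (ψ ∷ []) d)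
    ... | here e   | p′ = cutRight ih (⊃I e p′) d ⊆[]-refl ⊆[]-refl
    ... | there i′ | p′ = ⊃R i′ p′
    cutLeft ih (⊃L {φ} {ψ} i p q) s t d =
      ⊃L (carry (⊆[]⇒≽ s) s i)
        (cutLeft ih p s (⊆[]-under (φ ∷ []) id t) (weaken-after [] (φ ∷ []) d))
        (cutLeft ih q (⊆[]-++ (ψ ∷ []) (++-≽ (ψ ∷ [])) s)
          (⊆[]-under [] (++-≽ (ψ ∷ [])) t) (weaken-after (ψ ∷ []) [] d))
    cutLeft {A} ih (∀R {φ} i p) s t d
      with carry (⊆[]⇒≽ s) t i
         | (λ f y → cutLeft (below-ren {A} f ih) (p f y) (⊆[]-ren f s)
             (⊆[]-under (ren f φ ⟨ y ⟩ ∷ []) id (⊆[]-ren f t))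
             (weaken-after [] (_ ∷ []) (rename-proof f d)))
    ... | here e   | p′ = cutRight ih (∀I e p′) d ⊆[]-refl ⊆[]-refl
    ... | there i′ | p′ = ∀R i′ p′
    cutLeft ih (∀L {φ} z i p) s t d =
      ∀L z (carry (⊆[]⇒≽ s) s i)
        (cutLeft ih p (⊆[]-++ (φ ⟨ z ⟩ ∷ []) (++-≽ (φ ⟨ z ⟩ ∷ [])) s)
          (⊆[]-under [] (++-≽ (φ ⟨ z ⟩ ∷ [])) t) (weaken-after (φ ⟨ z ⟩ ∷ []) [] d))
    cutLeft {A} ih (modal R∈ τ z as ss p) s t d =
      cutLeft-modal ih R∈ τ z (All.map (carry (⊆[]⇒≽ s) s) as)
        (splitOff (All.map (carry (⊆[]⇒≽ s) t) ss))
        (λ P e f y → let Σ′ = map (instantiate f τ y) (ante P)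
                         Θ = map (instantiate f τ y) (succ P) in
          cutLeft (below-ren {A} f ih) (p P e f y) (⊆[]-++ Σ′ (++-≽ Σ′) (⊆[]-ren f s))
            (⊆[]-under Θ (++-≽ Σ′) (⊆[]-ren f t)) (weaken-after Σ′ Θ (rename-proof f d)))
        d

    cutBelow : ∀ n → CutBelow n
    cutBelow (suc n) B (s≤s B≤n) p q =
      cutLeft (λ C C<B → cutBelow n C (ℕ.≤-trans C<B B≤n)) p ⊆[]-refl ⊆[]-refl q

    cuttable : ∀ B → Cuttable B
    cuttable B = cutBelow (suc (size B)) B ℕ.≤-refl

  -- The modal principal case.

  decideAll : ∀ {Γ Δ} (F : SVar → Formula 0) xs → (∀ {x} → x ∈ˡ xs → Cuttable (F x)) → ∀ K →
              (∀ K′ → K ⊆ˢ K′ → (∀ {x} → x ∈ˡ xs → Decided x K′) →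
                map F (ante K′) ++ Γ ⟹ map F (succ K′) ++ Δ) →
              map F (ante K) ++ Γ ⟹ map F (succ K) ++ Δ
  decideAll F [] c K k = k K (id , id) (λ ())
  -- A cut on `F x` puts `x` on the right in one branch and on the left in the other, so that it is
  -- decided in both.
  decideAll F (x ∷ xs) c K@(Π ⇒ Ξ) k =
    c (here refl)
      (decideAll F xs (c ∘ there) (Π ⇒ x ∷ Ξ) λ K′ (s , t) d →
        k K′ (s , t ∘ there) λ { (here refl) → inj₂ (t (here refl)) ; (there m) → d m })
      (decideAll F xs (c ∘ there) (x ∷ Π ⇒ Ξ) λ K′ (s , t) d →
        k K′ (s ∘ there , t) λ { (here refl) → inj₁ (s (here refl)) ; (there m) → d m })

  tautological : ∀ {Γ Δ} (F : SVar → Formula 0) {K} → Tautology K →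
                 map F (ante K) ++ Γ ⟹ map F (succ K) ++ Δ
  tautological F taut with _ , p∈ , p∈′ ← find taut =
    ax (∈⇒∈[] (∈-++⁺ˡ (∈-map⁺ F p∈))) (∈⇒∈[] (∈-++⁺ˡ (∈-map⁺ F p∈′)))

  size-argument : ∀ {n q} (τ : SVar → Formula 1) (qs : Vec SVar n) → q ∈ˡ toList qs →
                  size (τ q) ≤ sizes (Vec.map τ qs)
  size-argument τ (q ∷ qs) (here refl) = ℕ.m≤m+n _ _
  size-argument τ (q ∷ qs) (there m)   = ℕ.≤-trans (size-argument τ qs m) (ℕ.m≤n+m _ (size (τ q)))

  modal-subject : ∀ {k u v ♥ ♥′ φs ψs} → _≡_ {A = Formula k} (modal u ♥ φs) (modal v ♥′ ψs) → u ≡ v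
  modal-subject refl = refl

  ~-modalAt⁻ : ∀ {Γ z w τ τ′} a b → Γ ⊢ modalAt z τ a ~ modalAt w τ′ b → Γ ⊢ z ≈ⁿ w
  ~-modalAt⁻ a b e f r = free-injective (modal-subject (e .under f r))

  modalAt-renameAtom : ∀ z τ ρ a → modalAt z (τ ∘ ρ) a ≡ modalAt z τ (renameAtom ρ a)
  modalAt-renameAtom z τ ρ (♥ · ps) = cong (modal (free z) ♥) (Vec.map-∘ τ ρ ps)

  rule-unique : ∀ R → Unique (concatMap svars (ante (conclusion (schema R)))) ×
                      Unique (concatMap svars (succ (conclusion (schema R))))
  rule-unique R =
    let as         = ante (conclusion (schema R))
        ss         = succ (conclusion (schema R))
        u , u′ , _ = unique-++⁻ (concatMap svars as)
                       (subst Unique (concatMap-++ svars as ss) (linear R))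
    in u , u′

  -- Passes from a rule's own assignment `τ` to another one that agrees with it along `ρ` modulo
  -- `Γ`.
  through : ∀ {Γ Δ τ τ′ ρ K K′} f y → (∀ p → Γ ⊢ τ p ~ τ′ (ρ p)) → mapSequent ρ K ⊆ˢ K′ →
            map (instantiate f τ y) (ante K) ++ map (ren f) Γ ⟹
            map (instantiate f τ y) (succ K) ++ map (ren f) Δ →
            map (instantiate f τ′ y) (ante K′) ++ map (ren f) Γ ⟹
            map (instantiate f τ′ y) (succ K′) ++ map (ren f) Δ
  through {Γ} {Δ} {τ} {τ′} {ρ} {K} {K′} f y agrees (s , t) p =
    repl p (All.++⁺ (images s) (⊆⇒⊆[] (∈-++⁺ʳ Σ′)))
      (All.++⁺ (images t) (⊆⇒⊆[] (∈-++⁺ʳ (map F (succ K′)))))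
    where
    F : SVar → Formula 0
    F = instantiate f τ′ y

    Σ′ : List (Formula 0)
    Σ′ = map F (ante K′)

    images : ∀ {ps qs Θ} → map ρ ps ⊆ˡ qs →
             map (instantiate f τ y) ps ⊆[ Σ′ ++ map (ren f) Γ ] (map F qs ++ Θ)
    images sub = All.map⁺ (All.tabulate λ {p} p∈ →
      ~∈ (~-mono (++-≽ Σ′) (~-⟨⟩ y (~-ren f (agrees p))))
        (∈⇒∈[] (∈-++⁺ˡ (∈-map⁺ F (sub (∈-map⁺ ρ p∈))))))

  matching-copies : ∀ {ρ xs others hs} {a : Atom} → xs ↭ others ++ hs →
                    map (renameAtom ρ) hs ≡ replicate (length hs) a →
                    map (renameAtom ρ) xs ↭ map (renameAtom ρ) others ++ replicate (length hs) a
  matching-copies {ρ} {others = others} {hs} perm copies =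
    ↭-trans (↭-map⁺ (renameAtom ρ) perm)
      (↭.↭-reflexive (trans (map-++ (renameAtom ρ) others hs)
        (cong (map (renameAtom ρ) others ++_) copies)))

  reduceModal : AbsorbsMulticut 𝓡 → ModalReduction
  reduceModal absorb {A} {Γ} {Δ} {R₁} {R₂} {τ₁} {τ₂} {z₁} {z₂} {others₁} {others₂}
    {h₁@(♥ · ps)} {h₂} {hs₁} {hs₂}
    ih R₁∈ R₂∈ perm₁ as₁ os₁ es₁@(e₁ ∷ _) p₁ perm₂ os₂ ss₂ es₂@(e₂ ∷ _) p₂ = conclude
      (absorb (inst R₁∈ U₁.ρ) (inst R₂∈ U₂.ρ) (♥ · qs) {length (h₁ ∷ hs₁)} {length (h₂ ∷ hs₂)}
        (s≤s z≤n) (s≤s z≤n)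
        (↭-refl , matching-copies perm₁ U₁.copies)
        ( ↭-trans (matching-copies perm₂ U₂.copies) (++-comm (map (renameAtom U₂.ρ) others₂) _)
        , ↭-refl))
    where
    qs : Vec SVar (ar ♥)
    qs = arguments (ar ♥)

    -- The first matching atom of `R₁` represents the cut formula; all other matching atoms of both
    -- rules agree with it modulo `Γ`.
    φs : Vec (Formula 1) (ar ♥)
    φs = Vec.map τ₁ ps

    τ : SVar → Formula 1
    τ = joint φs τ₁ τ₂

    U₁ : Unified Γ left τ₁ τ ♥ (h₁ ∷ hs₁)
    U₁ = unify left _ (occurrences-unique others₁ _ perm₁ (proj₂ (rule-unique R₁)))
      (All.map (λ e → ~-trans e (~-sym e₁)) es₁) (joint-arguments φs τ₁ τ₂) (joint-left φs τ₁ τ₂)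

    U₂ : Unified Γ right τ₂ τ ♥ (h₂ ∷ hs₂)
    U₂ = unify right _ (occurrences-unique others₂ _ perm₂ (proj₁ (rule-unique R₂)))
      (All.map (λ e → ~-trans e (~-sym e₁)) es₂) (joint-arguments φs τ₁ τ₂) (joint-right φs τ₁ τ₂)

    module U₁ = Unified U₁
    module U₂ = Unified U₂

    transfer : ∀ {z τᵢ ρᵢ ρ a c Θ} → Γ ⊢ z ≈ⁿ z₁ → (∀ p → Γ ⊢ τᵢ p ~ τ (ρᵢ p)) →
               renameAtom ρ a ≡ renameAtom ρᵢ c →
               modalAt z τᵢ c ∈[ Γ ] Θ → modalAt z₁ (τ ∘ ρ) a ∈[ Γ ] Θ
    transfer {z} {τᵢ} {ρᵢ} {ρ} {a} {c} z≈ agrees eq =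
      ~∈ (~-trans
        (~-reflexive (trans (modalAt-renameAtom z₁ τ ρ a)
          (trans (cong (modalAt z₁ τ) eq) (sym (modalAt-renameAtom z₁ τ ρᵢ c)))))
        (~-sym (~-modalAt c z≈ agrees)))

    transferAll : ∀ {ρ xs Θ} as₁ as₂ →
                  map (renameAtom ρ) xs ⊆ₘ
                    (map (renameAtom U₁.ρ) as₁ ++ map (renameAtom U₂.ρ) as₂) →
                  All (λ a → modalAt z₁ τ₁ a ∈[ Γ ] Θ) as₁ →
                  All (λ a → modalAt z₂ τ₂ a ∈[ Γ ] Θ) as₂ →
                  All (λ a → modalAt z₁ (τ ∘ ρ) a ∈[ Γ ] Θ) xs
    transferAll {ρ} {xs} {Θ} as₁ as₂ (_ , perm) is₁ is₂ = All.tabulate λ {a} a∈ →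
      [ fromLeft ∘ ∈-map⁻ (renameAtom U₁.ρ) , fromRight ∘ ∈-map⁻ (renameAtom U₂.ρ) ]′
        (∈-++⁻ (map (renameAtom U₁.ρ) as₁) (∈-resp-↭ perm (∈-++⁺ˡ (∈-map⁺ (renameAtom ρ) a∈))))
      where
      fromLeft : ∀ {a} → ∃[ c ] c ∈ˡ as₁ × renameAtom ρ a ≡ renameAtom U₁.ρ c →
                 modalAt z₁ (τ ∘ ρ) a ∈[ Γ ] Θ
      fromLeft {a} (c , c∈ , eq) =
        transfer {a = a} {c} (λ _ _ → refl) U₁.agrees eq (All.lookup is₁ c∈)

      fromRight : ∀ {a} → ∃[ c ] c ∈ˡ as₂ × renameAtom ρ a ≡ renameAtom U₂.ρ c →
                  modalAt z₁ (τ ∘ ρ) a ∈[ Γ ] Θ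
      fromRight {a} (c , c∈ , eq) =
        -- Both subjects agree with that of `A` modulo `Γ`, so the atoms of `R₂` can be moved to
        -- `z₁`.
        transfer {a = a} {c} (~-modalAt⁻ h₂ h₁ (~-trans e₂ (~-sym e₁))) U₂.agrees eq
          (All.lookup is₂ c∈)

    smaller : ∀ {f y q} → q ∈ˡ toList qs → size (instantiate f τ y q) < size A
    smaller {f} {y} {q} q∈ = subst₂ _<_
      (sym (trans (size-⟨⟩ (ren f (τ q)) y) (size-ren f (τ q))))
      (trans (cong (suc ∘ sizes) (joint-arguments φs τ₁ τ₂)) (~-size e₁))
      (s≤s (size-argument τ qs q∈))

    -- By covering, `K` follows from the premises of both rules together. As it decides the shared
    -- variables, it is a tautology or, by interpolation, contains a consequence of one rule's
    -- premises, which is available as a derivation.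
    leaf : ∀ {ρ} Qs →
           MCut (_∈ˡ map (mapSequent U₁.ρ) (premises (schema R₁)) ++
                     map (mapSequent U₂.ρ) (premises (schema R₂))) ▷ (_∈ˡ map (mapSequent ρ) Qs) →
           ∀ P → Qs ⊩ P → ∀ f y K → mapSequent ρ P ⊆ˢ K → (∀ {q} → q ∈ˡ toList qs → Decided q K) →
           map (instantiate f τ y) (ante K) ++ map (ren f) Γ ⟹
           map (instantiate f τ y) (succ K) ++ map (ren f) Δ
    leaf {ρ} Qs covers P e f y K sub decided with tautology? K
    ... | yes taut = tautological (instantiate f τ y) taut
    ... | no ¬taut
      with interpolate U₁.tagged U₂.tagged
             (λ v r → ▷⇒⊩ covers (⊩-map ρ e) v (refutes-⊆ sub r)) decided ¬taut
    ...   | inj₁ (K₁ , e₁ , sub₁) = through f y U₁.agrees sub₁ (p₁ K₁ e₁ f y)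
    ...   | inj₂ (K₂ , e₂ , sub₂) = through f y U₂.agrees sub₂ (p₂ K₂ e₂ f y)

    conclude : _ → Γ ⟹ Δ
    conclude (_ , inst {R} R∈ ρ , covers , covered) with _ , refl , (sub , sub′) ← covered refl =
      modal R∈ (τ ∘ ρ) z₁
        (transferAll _ others₂ sub as₁ os₂)
        (transferAll others₁ _ sub′ os₁ ss₂)
        (λ P e f y → let F = instantiate f τ y in
          cast (cong (_++ _) (sym (map-∘ (ante P)))) (cong (_++ _) (sym (map-∘ (succ P))))
            -- These cuts are on arguments of the cut formula only, hence below its size.
            (decideAll F (toList qs) (λ q∈ → ih _ (smaller {f} {y} q∈)) (mapSequent ρ P)
              (leaf (premises (schema R)) covers P e f y)))

  -- From the sequent system with a cut rule to the auxiliary calculus.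

  Holds : (Name → Name) → Sequent (Formula 0) → Set ℓ
  Holds f (Γ ⇒ Δ) = map (ren f) Γ ⟹ map (ren f) Δ

  Admissible : Rule₂ (Formula 0) → Set ℓ
  Admissible X = ∀ {S₁ S₂ S} → X S₁ S₂ S → ∀ f → Holds f S₁ → Holds f S₂ → Holds f S

  ∷-⊆-∷∷ : ∀ {A : Set} {x y : A} {xs} → x ∷ xs ⊆ˡ x ∷ y ∷ xs
  ∷-⊆-∷∷ (here e)  = here e
  ∷-⊆-∷∷ (there m) = there (there m)

  fresh-at : ∀ {y χ} {Θ : List (Formula 0)} → y ∉ concatMap fv Θ → χ ∈ˡ Θ → y ∉ fv χ
  fresh-at y∉ χ∈ y∈ = y∉ (∈-concatMap⁺ fv (lose χ∈ y∈))

  ren-fresh-∘ : ∀ g f {y} y′ χ → y ∉ fv χ → ren ((g ∘ f) [ y ↦ y′ ]) χ ≡ ren g (ren f {0} χ)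
  ren-fresh-∘ g f y′ χ y∉ = trans (ren-fresh (g ∘ f) χ y∉) (sym (ren-∘ g f χ))

  ren-⟨fresh⟩-∘ : ∀ g f {y} y′ (φ : Formula 1) → y ∉ fv φ →
                  ren ((g ∘ f) [ y ↦ y′ ]) (φ ⟨ y ⟩) ≡ ren g (ren f φ) ⟨ y′ ⟩
  ren-⟨fresh⟩-∘ g f y′ φ y∉ =
    trans (ren-⟨fresh⟩ (g ∘ f) y′ φ y∉) (cong (_⟨ y′ ⟩) (sym (ren-∘ g f φ)))

  map-ren-fresh-∘ : ∀ g f {y} y′ Γ → (∀ {χ} → χ ∈ˡ Γ → y ∉ fv χ) →
                    map (ren ((g ∘ f) [ y ↦ y′ ])) Γ ≡ map (ren g) (map (ren f) Γ)
  map-ren-fresh-∘ g f y′ Γ y∉ =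
    trans (map-cong-local (All.tabulate λ {χ} χ∈ → ren-fresh-∘ g f y′ χ (y∉ χ∈))) (map-∘ Γ)

  fv-modalAt : ∀ {z τ p} a → p ∈ˡ svars a → fv (τ p) ⊆ˡ fv (modalAt z τ a)
  fv-modalAt {τ = τ} (♥ · ps) p∈ = there ∘ go ps p∈
    where
    go : ∀ {n p} (ps : Vec SVar n) → p ∈ˡ toList ps → fv (τ p) ⊆ˡ fvs (Vec.map τ ps)
    go (p ∷ ps) (here refl) = ∈-++⁺ˡ
    go (q ∷ ps) (there p∈)  = ∈-++⁺ʳ (fv (τ q)) ∘ go ps p∈

  -- Any solution of `Γ` identifies `f x` with `f y`, hence also the two substitution instances. The
  -- equality rules thereby become replacements of equals.
  ~-[/] : ∀ {Γ f x y} z χ → Γ ⊢ f x ≈ⁿ f y → Γ ⊢ ren f {0} (χ [ x / z ]) ~ ren f (χ [ y / z ])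
  ~-[/] {f = f} {x} {y} z χ x≈y .under g r =
    trans (composite x) (trans (ren-cong χ agree) (sym (composite y)))
    where
    composite : ∀ t → ren g (ren f (χ [ t / z ])) ≡ ren (g ∘ f ∘ (id [ z ↦ t ])) χ
    composite t = trans (cong (ren g ∘ ren f) ([/]≡ren χ t z))
      (trans (cong (ren g) (ren-∘ f _ χ)) (ren-∘ g _ χ))

    agree : ∀ {a} → a ∈ˡ fv χ → g (f ((id [ z ↦ x ]) a)) ≡ g (f ((id [ z ↦ y ]) a))
    agree {a} _ with a ≟ z
    ... | yes _ = x≈y g r
    ... | no _  = refl

  ⊆[]-[/] : ∀ {Γ f x y} z Θ → Γ ⊢ f x ≈ⁿ f y →
            map (ren f) (map (_[ x / z ]) Θ) ⊆[ Γ ] map (ren f) (map (_[ y / z ]) Θ)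
  ⊆[]-[/] {f = f} z Θ x≈y = All.map⁺ (All.map⁺ (All.tabulate λ {χ} χ∈ →
    ~∈ (~-[/] z χ x≈y) (∈⇒∈[] (∈-map⁺ (ren f) (∈-map⁺ _ χ∈)))))

  ⊆[]-there : ∀ {Γ Θ Ξ φ} → Θ ⊆[ Γ ] Ξ → Θ ⊆[ Γ ] (φ ∷ Ξ)
  ⊆[]-there = All.map there

  module Soundness (cuttable : ∀ B → Cuttable B)
                   {X : Rule₂ (Formula 0)} (admissible : Admissible X) where

    holds : ∀ {S} → Derivable 𝓡 X S → ∀ f → Holds f S

    holdsAll : ∀ {Ps : List (Sequent SVar)} {S : Sequent SVar → Sequent (Formula 0)} →
               All (Derivable 𝓡 X ∘ S) Ps → All (λ P → ∀ f → Holds f (S P)) Ps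

    holds-step : ∀ {R Σ′ Θ} → R ∈ 𝓡 → ∀ τ z y →
                 let C      = mapSequent (modalAt z τ) (conclusion (schema R))
                     result = Σ′ ++ ante C ⇒ succ C ++ Θ
                 in y FreshFor result →
                    All (λ P → ∀ f → Holds f (Σ′ ++ map (λ p → τ p ⟨ y ⟩) (ante P) ⇒
                                              map (λ p → τ p ⟨ y ⟩) (succ P) ++ Θ))
                        (premises (schema R)) →
                    ∀ f → Holds f result

    holds (exchange (p , q) d) f =
      weaken (holds d f) (∈-resp-↭ (↭-map⁺ (ren f) p)) (∈-resp-↭ (↭-map⁺ (ren f) q))
    holds ax f = ax (here ~-refl) (here ~-refl)
    holds ⊥L f = ⊥L (here ~-refl)
    holds ≈R f = ≈R (here ~-refl)
    holds (⊃R d) f = ⊃R (here ~-refl) (weaken (holds d f) id ∷-⊆-∷∷)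
    holds (⊃L d e) f =
      ⊃L (here ~-refl) (weaken (holds d f) there id) (weaken (holds e f) ∷-⊆-∷∷ id)
    holds (∀R {Γ} {Δ} {φ} {y} y∉ d) f =
      -- Freshness of `y` allows a renaming that sends it to `y′` and acts as `g ∘ f` on the
      -- conclusion.
      ∀R (here (~-reflexive (sym (ren-∀ f φ)))) λ g y′ →
        weaken
          (cast (map-ren-fresh-∘ g f y′ Γ (λ m → fresh-at y∉ (∈-++⁺ˡ m)))
            (cong₂ _∷_ (ren-⟨fresh⟩-∘ g f y′ φ (fresh-at y∉ (∈-++⁺ʳ Γ (here refl))))
              (map-ren-fresh-∘ g f y′ Δ (λ m → fresh-at y∉ (∈-++⁺ʳ Γ (there m)))))
            (holds d ((g ∘ f) [ y ↦ y′ ])))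
          id ∷-⊆-∷∷
    holds (∀L {φ = φ} {z} d) f =
      ∀L (f z) (here (~-reflexive (sym (ren-∀ f φ))))
        (weaken (cast (cong (_∷ _) (ren-⟨⟩ f φ z)) refl (holds d f)) ∷-⊆-∷∷ id)
    holds (≈L₁ {Γ} {Δ} {x} {y} {z} d) f =
      repl (holds d f) (here ~-refl ∷ ⊆[]-there (⊆[]-[/] z Γ (λ g r → r (here refl))))
        (⊆[]-[/] z Δ (λ g r → r (here refl)))
    holds (≈L₂ {Γ} {Δ} {x} {y} {z} d) f =
      repl (holds d f) (here ~-refl ∷ ⊆[]-there (⊆[]-[/] z Γ (λ g r → sym (r (here refl)))))
        (⊆[]-[/] z Δ (λ g r → sym (r (here refl))))
    holds (weakenL d) f = weaken (holds d f) there id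
    holds (weakenR d) f = weaken (holds d f) id there
    holds (contrL d) f = weaken (holds d f) (λ { (here e) → here e ; (there m) → m }) id
    holds (contrR d) f = weaken (holds d f) id (λ { (here e) → here e ; (there m) → m })
    holds (step R∈ τ z y y∉ ds) f = holds-step R∈ τ z y y∉ (holdsAll ds) f
    holds (extra x d e) f = admissible x f (holds d f) (holds e f)

    holdsAll []       = []
    holdsAll (d ∷ ds) = holds d ∷ holdsAll ds

    holds-step {R} {Σ′} {Θ} R∈ τ z y y∉ ds f =
      modal R∈ (ren f ∘ τ) (f z) (principal (∈-++⁺ʳ Σ′)) (principal ∈-++⁺ˡ) λ P e g y′ →
        -- Cutting on every variable of the premises leaves sequents that are tautological or
        -- contain an actual premise of the rule.
        decideAll (instantiate g (ren f ∘ τ) y′) (varsOf (premises (schema R))) (λ _ → cuttable _) P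
          (leaf P e g y′)
      where
      C : Sequent (Formula 0)
      C = mapSequent (modalAt z τ) (conclusion (schema R))

      principal : ∀ {as Γ Δ} → map (modalAt z τ) as ⊆ˡ Δ →
                  All (λ a → modalAt (f z) (ren f ∘ τ) a ∈[ Γ ] map (ren f) Δ) as
      principal sub = All.tabulate λ {a} a∈ →
        ~∈ (~-reflexive (sym (ren-modalAt f z τ a)))
          (∈⇒∈[] (∈-map⁺ (ren f) (sub (∈-map⁺ (modalAt z τ) a∈))))

      fresh-body : ∀ {p} → p ∈ˡ conclusionVars (schema R) → y ∉ fv (τ p)
      fresh-body p∈ y∈ with a , a∈ , p∈a ← find (∈-concatMap⁻ svars p∈) =
        fresh-at y∉ (placed (∈-++⁻ (ante (conclusion (schema R))) a∈)) (fv-modalAt a p∈a y∈)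
        where
        placed : ∀ {a} → a ∈ˡ ante (conclusion (schema R)) ⊎ a ∈ˡ succ (conclusion (schema R)) →
                 modalAt z τ a ∈ˡ (Σ′ ++ ante C) ++ (succ C ++ Θ)
        placed (inj₁ m) = ∈-++⁺ˡ (∈-++⁺ʳ Σ′ (∈-map⁺ _ m))
        placed (inj₂ m) = ∈-++⁺ʳ (Σ′ ++ ante C) (∈-++⁺ˡ (∈-map⁺ _ m))

      leaf : ∀ P → premises (schema R) ⊩ P → ∀ g y′ K → P ⊆ˢ K →
             (∀ {x} → x ∈ˡ varsOf (premises (schema R)) → Decided x K) →
             let F = instantiate g (ren f ∘ τ) y′ in
             map F (ante K) ++ map (ren g) (map (ren f) (Σ′ ++ ante C)) ⟹
             map F (succ K) ++ map (ren g) (map (ren f) (succ C ++ Θ))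
      leaf P e g y′ K sub decided with member-or-tautology {K = K} e sub decided
      ... | inj₂ taut = tautological _ {K} taut
      ... | inj₁ any with Q , Q∈ , (s , t) ← find any =
        repl (All.lookup ds Q∈ h)
          (All.map⁺ (All.++⁺
            (All.tabulate λ m → context (∈-++⁺ˡ (∈-++⁺ˡ m))
                                        (∈-++⁺ʳ (map F (ante K)) (∈-map² (∈-++⁺ˡ m))))
            (All.map⁺ (All.tabulate λ m → body (∈-++⁺ˡ m) (∈-++⁺ˡ (∈-map⁺ F (s m)))))))
          (All.map⁺ (All.++⁺
            (All.map⁺ (All.tabulate λ m → body (∈-++⁺ʳ (ante Q) m) (∈-++⁺ˡ (∈-map⁺ F (t m)))))
            (All.tabulate λ m → context (∈-++⁺ʳ (Σ′ ++ ante C) (∈-++⁺ʳ (succ C) m))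
                                        (∈-++⁺ʳ (map F (succ K)) (∈-map² (∈-++⁺ʳ (succ C) m))))))
        where
        F : SVar → Formula 0
        F = instantiate g (ren f ∘ τ) y′

        h : Name → Name
        h = (g ∘ f) [ y ↦ y′ ]

        ∈-map² : ∀ {χ Ξ} → χ ∈ˡ Ξ → ren g (ren f χ) ∈ˡ map (ren g) (map (ren f) Ξ)
        ∈-map² m = ∈-map⁺ (ren g) (∈-map⁺ (ren f) m)

        context : ∀ {Γ Δ χ} → χ ∈ˡ (Σ′ ++ ante C) ++ (succ C ++ Θ) → ren g (ren f χ) ∈ˡ Δ →
                  ren h χ ∈[ Γ ] Δ
        context {χ = χ} χ∈ m = ~∈ (~-reflexive (ren-fresh-∘ g f y′ χ (fresh-at y∉ χ∈))) (∈⇒∈[] m)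

        body : ∀ {Γ Δ p} → p ∈ˡ ante Q ++ succ Q → F p ∈ˡ Δ → ren h (τ p ⟨ y ⟩) ∈[ Γ ] Δ
        -- Every variable of a premise occurs in the conclusion of the rule, so `y` is fresh for its
        -- body.
        body {p = p} p∈ m =
          ~∈ (~-reflexive (ren-⟨fresh⟩-∘ g f y′ (τ p)
                (fresh-body (All.lookup (All.lookup (scoped R) Q∈) p∈))))
            (∈⇒∈[] m)

  -- The cut rules in the auxiliary calculus.

  cut-admissible : (∀ B → Cuttable B) → Admissible Cut
  cut-admissible c (cut Γ Δ Σ′ Θ φ) f p q =
    c (ren f φ)
      (weaken p (⊆-map⁺ (ren f) ∈-++⁺ˡ) (⊆-map⁺ (ren f) (∷⁺ʳ φ ∈-++⁺ˡ)))
      (weaken q (⊆-map⁺ (ren f) (∷⁺ʳ φ (∈-++⁺ʳ Γ))) (⊆-map⁺ (ren f) (∈-++⁺ʳ Δ)))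

  -- Weakening there depends on contexts as sets only, so all copies of `φ` merge into one.
  mcut-admissible : (∀ B → Cuttable B) → Admissible Mcut
  mcut-admissible c (mcut Γ Δ Σ′ Θ φ {m} {n} _ _) f p q =
    c (ren f φ)
      (weaken p (⊆-map⁺ (ren f) ∈-++⁺ˡ) (⊆-map⁺ (ren f) contractR))
      (weaken q (⊆-map⁺ (ren f) contractL) (⊆-map⁺ (ren f) (∈-++⁺ʳ Δ)))
    where
    copies : ∀ {χ Ξ} m → χ ∈ˡ replicate m φ → χ ∈ˡ φ ∷ Ξ
    copies {Ξ = Ξ} m = All.lookup {P = _∈ˡ φ ∷ Ξ} (All.replicate⁺ m (here refl))

    contractR : Δ ++ replicate m φ ⊆ˡ φ ∷ Δ ++ Θ
    contractR = [ there ∘ ∈-++⁺ˡ , copies m ]′ ∘ ∈-++⁻ Δ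

    contractL : replicate n φ ++ Σ′ ⊆ˡ φ ∷ Γ ++ Σ′
    contractL = [ copies n , there ∘ ∈-++⁺ʳ Γ ]′ ∘ ∈-++⁻ (replicate n φ)

  -- From the auxiliary calculus back to the sequent system without cut.

  module Completeness where

    Derivable₀ : List (Formula 0) → List (Formula 0) → Set ℓ
    Derivable₀ Γ Δ = Derivable 𝓡 NoRule (Γ ⇒ Δ)

    castD : ∀ {Γ Γ′ Δ Δ′} → Γ ≡ Γ′ → Δ ≡ Δ′ → Derivable₀ Γ Δ → Derivable₀ Γ′ Δ′
    castD refl refl d = d

    weakenAllL : ∀ Σ′ {Γ Δ} → Derivable₀ Γ Δ → Derivable₀ (Σ′ ++ Γ) Δ
    weakenAllL []       d = d
    weakenAllL (φ ∷ Σ′) d = weakenL (weakenAllL Σ′ d)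

    weakenAllR : ∀ Θ {Γ Δ} → Derivable₀ Γ Δ → Derivable₀ Γ (Θ ++ Δ)
    weakenAllR []      d = d
    weakenAllR (φ ∷ Θ) d = weakenR (weakenAllR Θ d)

    -- Each formula of `Γ` is contracted with a copy of it that remains because `Γ′` contains one.
    contractAllL : ∀ Γ {Γ′ Δ} → Γ ⊆ˡ Γ′ → Derivable₀ (Γ ++ Γ′) Δ → Derivable₀ Γ′ Δ
    contractAllL [] sub d = d
    contractAllL (φ ∷ Γ) {Γ′} sub d
      with xs , ys , eq ← ∈-∃++ (∈-++⁺ʳ Γ {ys = Γ′} (sub (here refl))) =
      contractAllL Γ (sub ∘ there)
        (castD (sym eq) refl
          (exchange (↭-sym (shift φ xs ys) , ↭-refl)
            (contrL (exchange (↭.prep φ (↭-trans (↭.↭-reflexive eq) (shift φ xs ys)) , ↭-refl) d))))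

    contractAllR : ∀ Δ {Γ Δ′} → Δ ⊆ˡ Δ′ → Derivable₀ Γ (Δ ++ Δ′) → Derivable₀ Γ Δ′
    contractAllR [] sub d = d
    contractAllR (φ ∷ Δ) {Δ′ = Δ′} sub d
      with xs , ys , eq ← ∈-∃++ (∈-++⁺ʳ Δ {ys = Δ′} (sub (here refl))) =
      contractAllR Δ (sub ∘ there)
        (castD refl (sym eq)
          (exchange (↭-refl , ↭-sym (shift φ xs ys))
            (contrR (exchange (↭-refl , ↭.prep φ (↭-trans (↭.↭-reflexive eq) (shift φ xs ys))) d))))

    structural : ∀ {Γ Δ Γ′ Δ′} → Derivable₀ Γ Δ → Γ ⊆ˡ Γ′ → Δ ⊆ˡ Δ′ → Derivable₀ Γ′ Δ′
    structural {Γ} {Δ} {Γ′} {Δ′} d s t =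
      contractAllL Γ s (contractAllR Δ t
        (exchange (++-comm Γ′ Γ , ++-comm Δ′ Δ) (weakenAllL Γ′ (weakenAllR Δ′ d))))

    ∷-⊆ : ∀ {A : Set} {x : A} {xs} → x ∈ˡ xs → x ∷ xs ⊆ˡ xs
    ∷-⊆ x∈ (here refl) = x∈
    ∷-⊆ x∈ (there m)   = m

    [x]-⊆ : ∀ {A : Set} {x : A} {xs} → x ∈ˡ xs → x ∷ [] ⊆ˡ xs
    [x]-⊆ x∈ (here refl) = x∈

    map-[/] : ∀ t x (Γ : List (Formula 0)) → map (_[ t / x ]) Γ ≡ map (ren (id [ x ↦ t ])) Γ
    map-[/] t x = map-cong (λ φ → [/]≡ren φ t x)

    map-[x/x] : ∀ x (Γ : List (Formula 0)) → map (_[ x / x ]) Γ ≡ Γ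
    map-[x/x] x Γ = trans (map-[/] x x Γ)
      (trans (map-cong (λ φ → ren-cong φ (λ {a} _ → identity a)) Γ) (map-ren-id Γ))
      where
      identity : id [ x ↦ x ] ≗ id
      identity a with a ≟ x
      ... | yes refl = refl
      ... | no _     = refl

    identify : ∀ {Γ Δ x y} → (free x ≈ free y) ∈ˡ Γ →
               Derivable₀ (map (ren (id [ y ↦ x ])) Γ) (map (ren (id [ y ↦ x ])) Δ) → Derivable₀ Γ Δ
    identify {Γ} {Δ} {x} {y} x≈y d =
      structural
        (castD (cong (_ ∷_) (map-[x/x] y Γ)) (map-[x/x] y Δ)
          -- With `y` itself as the replaced variable, the conclusion is left unchanged and the
          -- premise has `x` for `y`; the extra equation is then contracted.
          (≈L₁ {Γ = Γ} {Δ} {x} {y} {y}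
            (weakenL (castD (sym (map-[/] x y Γ)) (sym (map-[/] x y Δ)) d))))
        (∷-⊆ x≈y) id

    DerivableAt : List (Formula 0) → List (Formula 0) → (Name → Name) → Set ℓ
    DerivableAt Γ Δ f = Derivable₀ (map (ren f) Γ) (map (ren f) Δ)

    -- By ≈L₁ every equation of Γ can be applied, as a substitution, to the whole sequent.
    respecting : ∀ Γ Δ f → (∀ h → Resp h Γ → DerivableAt Γ Δ h) → DerivableAt Γ Δ f
    respecting Γ Δ f k = go Γ f id (λ g r → k (g ∘ f) r)
      where
      skip : ∀ {f e Es} → (∀ {a b} → free a ≈ free b ≢ e) → Resp f Es → Resp f (e ∷ Es)
      skip ≢e r (here eq) = contradiction eq ≢e
      skip ≢e r (there m) = r m

      go : ∀ Es h → Es ⊆ˡ Γ → (∀ g → Resp (g ∘ h) Es → DerivableAt Γ Δ (g ∘ h)) → DerivableAt Γ Δ h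
      go [] h sub k = k id (λ ())
      go (free a ≈ free b ∷ Es) h sub k =
        identify (∈-map⁺ (ren h) (sub (here refl)))
          (castD (sym (map-ren-∘ _ h Γ)) (sym (map-ren-∘ _ h Δ))
            (go Es (s ∘ h) (sub ∘ there) λ g r → k (g ∘ s) λ
              { (here refl) → cong g (trans (s-source (h a)) (sym (↦-here id (h b))))
              ; (there m)   → r m }))
        where
        -- Both sides of the equation go to `h a` under `s`, so every renaming that factors through
        -- `s ∘ h` solves it.
        s : Name → Name
        s = id [ h b ↦ h a ]

        s-source : ∀ c → (id [ h b ↦ c ]) c ≡ c
        s-source c with c ≟ h b
        ... | yes _ = refl
        ... | no _  = refl
      go (e@(pred _ _) ∷ Es) h sub k = go Es h (sub ∘ there) λ g r → k g (skip (λ ()) r)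
      go (e@⊥ᶠ ∷ Es) h sub k = go Es h (sub ∘ there) λ g r → k g (skip (λ ()) r)
      go (e@(_ ⊃ _) ∷ Es) h sub k = go Es h (sub ∘ there) λ g r → k g (skip (λ ()) r)
      go (e@(∀ᶠ _) ∷ Es) h sub k = go Es h (sub ∘ there) λ g r → k g (skip (λ ()) r)
      go (e@(modal _ _ _) ∷ Es) h sub k = go Es h (sub ∘ there) λ g r → k g (skip (λ ()) r)

    exact : ∀ {f Γ Δ φ} → Resp f Γ → φ ∈[ Γ ] Δ → ren f φ ∈ˡ map (ren f) Δ
    exact {f} r = Any.map⁺ ∘ Any.map (λ e → e .under f r)

    -- It suffices to treat renamings that solve the equations of `Γ`. Under these, membership
    -- modulo `Γ` is literal membership, and each inference becomes one of the sequent system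
    -- followed by contraction.
    derivable : ∀ {Γ Δ} → Γ ⟹ Δ → ∀ f → DerivableAt Γ Δ f
    derivable {Γ} {Δ} (ax i j) f = respecting Γ Δ f λ h r →
      structural ax ([x]-⊆ (exact r i)) ([x]-⊆ (exact r j))
    derivable {Γ} {Δ} (⊥L i) f = respecting Γ Δ f λ h r → structural ⊥L ([x]-⊆ (exact r i)) (λ ())
    derivable {Γ} {Δ} (≈R i) f = respecting Γ Δ f λ h r → structural ≈R (λ ()) ([x]-⊆ (exact r i))
    derivable {Γ} {Δ} (⊃R i p) f = respecting Γ Δ f λ h r →
      structural (⊃R (derivable p h)) id (∷-⊆ (exact r i))
    derivable {Γ} {Δ} (⊃L i p q) f = respecting Γ Δ f λ h r →
      structural (⊃L (derivable p h) (derivable q h)) (∷-⊆ (exact r i)) id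
    derivable {Γ} {Δ} (∀R {φ} i p) f = respecting Γ Δ f λ h r →
      -- The premise holds for every name, so an eigenvariable fresh for the renamed conclusion can
      -- be picked.
      let y , y∉ = fresh (concatMap fv (map (ren h) Γ ++ ∀ᶠ (ren h φ) ∷ map (ren h) Δ)) in
      structural (∀R y∉ (castD (map-ren-id _) (map-ren-id _) (derivable (p h y) id)))
        id (∷-⊆ (subst (_∈ˡ map (ren h) Δ) (ren-∀ h φ) (exact r i)))
    derivable {Γ} {Δ} (∀L {φ} z i p) f = respecting Γ Δ f λ h r →
      structural (∀L (castD (cong (_∷ _) (ren-⟨⟩ h φ z)) refl (derivable p h)))
        (∷-⊆ (subst (_∈ˡ map (ren h) Γ) (ren-∀ h φ) (exact r i))) id
    derivable {Γ} {Δ} (modal {R} R∈ τ z as ss p) f = respecting Γ Δ f λ h r →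
      let hΓ = map (ren h) Γ
          hΔ = map (ren h) Δ
          C  = mapSequent (modalAt (h z) (ren h ∘ τ)) (conclusion (schema R))
          y , y∉ = fresh (concatMap fv ((hΓ ++ ante C) ++ (succ C ++ hΔ)))
      in structural
        -- Of all the consequences provided, those that are premises of the rule suffice.
        (step R∈ (ren h ∘ τ) (h z) y y∉ (All.tabulate λ {P} P∈ →
          exchange (++-comm (map (instantiate h τ y) (ante P)) hΓ , ↭-refl)
            (castD (map-ren-id _) (map-ren-id _) (derivable (p P (∈⇒⊩ P∈) h y) id))))
        ([ id , principal h r as ]′ ∘ ∈-++⁻ hΓ)
        ([ principal h r ss , id ]′ ∘ ∈-++⁻ (succ C))
      where
      principal : ∀ h → Resp h Γ → ∀ {xs Θ} → All (λ a → modalAt z τ a ∈[ Γ ] Θ) xs →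
                  map (modalAt (h z) (ren h ∘ τ)) xs ⊆ˡ map (ren h) Θ
      principal h r {Θ = Θ} is m with a , a∈ , refl ← ∈-map⁻ _ m =
        subst (_∈ˡ map (ren h) Θ) (ren-modalAt h z τ a) (exact r (All.lookup is a∈))

  -- Elimination of the cut rules by passing through the auxiliary calculus.

  eliminate : ∀ {X} → (∀ B → Cuttable B) → Admissible X → Derivable 𝓡 X ⊆ Derivable 𝓡 NoRule
  eliminate c adm d =
    castD (trans (map-ren-id _) (map-ren-id _)) (trans (map-ren-id _) (map-ren-id _))
      (derivable (holds d id) id)
    where
    open Soundness c adm
    open Completeness

theorem6p17 : ∀ {ℓ : Level} (𝒮 : Signature) → let open CPL 𝒮 in
    (𝒯 : Structure) (𝓡 : Pred OneStepRule ℓ) →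
    (∀ {R} → R ∈ 𝓡 → OneStepSound 𝒯 R) →
    AbsorbsMulticut 𝓡 →
    (Derivable 𝓡 Mcut ⊆ Derivable 𝓡 NoRule) × (Derivable 𝓡 Cut ⊆ Derivable 𝓡 NoRule)
theorem6p17 𝒮 𝒯 𝓡 sound absorb =
  eliminate cuttable (mcut-admissible cuttable) , eliminate cuttable (cut-admissible cuttable)
  where
  open Calculus 𝒮 𝓡
  open CutStep (reduceModal absorb)
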